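{- For all $k\ge0$, \[ D_k:=\sum_{v=4^k}^{4^{k+1}-1}\bigl(F_A(v)-F_B(v)\bigr)=\binom{2k+2}{k+1}. \]
   Context: Let $\widetilde Q(1)=\widetilde Q(2)=1$ and $\widetilde Q(n)=\widetilde Q(n-\widetilde Q(n-1))+\widetilde Q(n-\widetilde Q(n-2))+(-1)^n$ for $n\ge3$ (well defined, all values odd). Put $A(m):=(\widetilde Q(2m-1)+1)/2$ and $B(m):=(\widetilde Q(2m)+1)/2$ for $m\ge1$. For $v\in\mathbb{N}$ let $F_A(v):=\#\{m\ge1:A(m)=v\}$ and $F_B(v):=\#\{m\ge1:B(m)=v\}$ (these are finite). -}

module Defs where

open import Data.Nat using (ℕ; zero; suc; _+_; _*_; _∸_; _^_; _≤_; _<_; _≟_; _≤ᵇ_; ⌊_/2⌋)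
open import Data.Nat.Combinatorics using (_C_)
open import Data.Bool using (Bool; true; false; if_then_else_)
open import Data.List using (List; length; map; upTo)
open import Data.List.Relation.Unary.Unique.Propositional using (Unique)
open import Data.List.Membership.Propositional using (_∈_)
open import Data.Integer as ℤ using (ℤ; +_)
open import Data.Product using (Σ; _×_; _,_)
open import Function.Bundles using (_⇔_)
open import Relation.Nullary.Decidable using (⌊_⌋)

isEven : ℕ → Bool
isEven zero = true
isEven (suc zero) = false
isEven (suc (suc n)) = isEven n

-- Qtab n i = Q̃(i) for 1 ≤ i ≤ n, and 0 (a dummy value) otherwise.
-- The recursion for Q̃ is well defined (indices n - Q̃(n-1), n - Q̃(n-2) lie in [1, n-1]
-- and all values are odd positive), so the dummy value never influences Q̃ itself.
Qtab : ℕ → ℕ → ℕ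
Qtab zero _ = 0
Qtab (suc n) i = if ⌊ i ≟ suc n ⌋ then new else Qtab n i
  where
  t : ℕ → ℕ
  t = Qtab n
  s : ℕ
  s = t (suc n ∸ t n) + t (suc n ∸ t (n ∸ 1))
  new : ℕ
  new = if suc n ≤ᵇ 2 then 1 else (if isEven (suc n) then s + 1 else s ∸ 1)

Qt : ℕ → ℕ
Qt n = Qtab n n

A : ℕ → ℕ
A m = ⌊ (Qt (2 * m ∸ 1) + 1) /2⌋

B : ℕ → ℕ
B m = ⌊ (Qt (2 * m) + 1) /2⌋

HasCount : (ℕ → Set) → ℕ → Set
HasCount P c = Σ (List ℕ) λ xs → Unique xs × (∀ m → (m ∈ xs ⇔ P m)) × length xs ≡ c
  where open import Relation.Binary.PropositionalEquality using (_≡_)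

IsFA : ℕ → ℕ → Set
IsFA v c = HasCount (λ m → 1 ≤ m × A m ≡ v) c
  where open import Relation.Binary.PropositionalEquality using (_≡_)

IsFB : ℕ → ℕ → Set
IsFB v c = HasCount (λ m → 1 ≤ m × B m ≡ v) c
  where open import Relation.Binary.PropositionalEquality using (_≡_)

sumFrom : ℕ → ℕ → (ℕ → ℤ) → ℤ
sumFrom a zero f = + 0
sumFrom a (suc len) f = f a ℤ.+ sumFrom (suc a) len f

{-# OPTIONS --safe #-}
-- Let c be the ±-word, with counters u and w, for which u advances at each + and w at each −, and
-- in which the next letter is the negation of the letter that the pointer just moved reads in the
-- word itself.  Up to shifts that change only where the two pointers meet (at 1, 3, 11, 43, …), A
-- follows u and B follows w.  The invariants u (u n) = w (suc (w n)) at a +, and one more at a −,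
-- determine the lattice points (u , w) which the walk visits.  With them, two families of points
-- symmetric about 4 ^ k and 2 * 4 ^ k are propagated from level to level; their distances E k i
-- from 4 ^ k obey Pascal's rule applied twice, plus one, and vanish for i = 0.  The first m with
-- A m = 4 ^ k and the first m with B m = 4 ^ k differ by 2 E k 1, and D_k is the increment of
-- this quantity, a central binomial coefficient.
module Submission where

open import Defs
open import Data.Bool using (Bool; true; false; not; if_then_else_)
open import Data.Empty using (⊥; ⊥-elim)
open import Data.List using (List; []; _∷_; length; filter; downFrom)
open import Data.List.Membership.Propositional using (_∈_)
open import Data.List.Membership.Propositional.Properties using (∈-filter⁺; ∈-filter⁻; ∈-downFrom⁺)
open import Data.List.Properties using (filter-accept; filter-reject)
open import Data.List.Relation.Unary.Unique.Propositional.Properties using (downFrom⁺; filter⁺)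
open import Data.Nat
open import Data.Nat.Combinatorics using (_C_; nCk+nC[k+1]≡[n+1]C[k+1]; nCk≡nC[n∸k])
open import Data.Nat.Induction using (<-rec)
open import Data.Nat.Properties
open import Data.Nat.Tactic.RingSolver using (solve-∀)
open import Data.Product using (Σ; _×_; _,_; ∃-syntax; proj₁; proj₂)
open import Data.Sum using (_⊎_; inj₁; inj₂)
open import Function using (_∘_)
open import Function.Bundles using (mk⇔)
open import Relation.Binary.Definitions using (tri<; tri≈; tri>)
open import Relation.Binary.PropositionalEquality
open import Relation.Nullary using (yes; no)
open import Relation.Nullary.Decidable using (⌊_⌋)

-- The word, its letters and its two counters

abstract

  -- tab n i is the letter c i for i ≤ n.
  tab : ℕ → ℕ → Bool
  u w : ℕ → ℕ

  tab 0 _ = true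
  tab 1 _ = true
  tab (suc (suc n)) i =
    if ⌊ i ≟ suc (suc n) ⌋
    -- A + reads the position that its pointer leaves, a - the position that its pointer enters.
    -- Neither exceeds the current index, so the table already holds that letter.
    then not (tab (suc n) (if tab (suc n) (suc n) then u (suc n) else suc (w (suc n))))
    else tab (suc n) i

  u zero    = 0
  u (suc n) = if tab n n then suc (u n) else u n

  w zero    = 1
  w (suc n) = if tab n n then w n else suc (w n)

  c : ℕ → Bool
  c n = tab n n

  tab-suc : ∀ n {i} → i ≤ n → tab (suc n) i ≡ tab n i
  tab-suc zero _ = refl
  tab-suc (suc n) {i} i≤n with i ≟ suc (suc n)
  ... | yes refl = ⊥-elim (1+n≰n i≤n)
  ... | no _     = refl

  tab-stable : ∀ {n i} → i ≤′ n → tab n i ≡ c i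
  tab-stable ≤′-refl       = refl
  tab-stable (≤′-step i≤n) = trans (tab-suc _ (≤′⇒≤ i≤n)) (tab-stable i≤n)

  u-plus : ∀ {n} → c n ≡ true → u (suc n) ≡ suc (u n)
  u-plus e rewrite e = refl

  w-plus : ∀ {n} → c n ≡ true → w (suc n) ≡ w n
  w-plus e rewrite e = refl

  u-minus : ∀ {n} → c n ≡ false → u (suc n) ≡ u n
  u-minus e rewrite e = refl

  w-minus : ∀ {n} → c n ≡ false → w (suc n) ≡ suc (w n)
  w-minus e rewrite e = refl

  u+w : ∀ n → u n + w n ≡ suc n
  u+w zero = refl
  u+w (suc n) with c n
  ... | true  = cong suc (u+w n)
  ... | false = trans (+-suc (u n) (w n)) (cong suc (u+w n))

  u-suc : ∀ n → u n ≤ u (suc n)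
  u-suc n with c n
  ... | true  = n≤1+n _
  ... | false = ≤-refl

  w-suc : ∀ n → w n ≤ w (suc n)
  w-suc n with c n
  ... | true  = ≤-refl
  ... | false = n≤1+n _

  c-one : c 1 ≡ true
  c-one = refl

  u-one : u 1 ≡ 1
  u-one = refl

  w-one : w 1 ≡ 1
  w-one = refl

  w-zero : w 0 ≡ 1
  w-zero = refl

  minus⇒2≤ : ∀ {n} → c n ≡ false → 2 ≤ n
  minus⇒2≤ {suc (suc n)} _ = s≤s (s≤s z≤n)

  c-suc : ∀ n → 1 ≤ n → c (suc n) ≡ not (tab n (if c n then u n else suc (w n)))
  c-suc (suc n) _ with suc (suc n) ≟ suc (suc n)
  ... | yes _ = refl
  ... | no ne = ⊥-elim (ne refl)

  c-suc-at : ∀ {n i} → 1 ≤ n → (if c n then u n else suc (w n)) ≡ i → i ≤ n → c (suc n) ≡ not (c i)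
  c-suc-at {n} 1≤n refl i≤n = trans (c-suc n 1≤n) (cong not (tab-stable (≤⇒≤′ i≤n)))

  c-plus-≤ : ∀ {n} → 1 ≤ n → c n ≡ true → u n ≤ n → c (suc n) ≡ not (c (u n))
  c-plus-≤ {n} 1≤n e = c-suc-at 1≤n (cong (λ b → if b then u n else suc (w n)) e)

  c-minus-< : ∀ {n} → 1 ≤ n → c n ≡ false → w n < n → c (suc n) ≡ not (c (suc (w n)))
  c-minus-< {n} 1≤n e = c-suc-at 1≤n (cong (λ b → if b then u n else suc (w n)) e)

monotone : (f : ℕ → ℕ) → (∀ n → f n ≤ f (suc n)) → ∀ {m n} → m ≤ n → f m ≤ f n
monotone f step {m} {n} m≤n with m≤n⇒m<n∨m≡n m≤n
... | inj₂ refl = ≤-refl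
monotone f step {m} {suc n} m≤n | inj₁ (s≤s m≤n′) = ≤-trans (monotone f step m≤n′) (step n)

u-mono : ∀ {m n} → m ≤ n → u m ≤ u n
u-mono = monotone u u-suc

w-mono : ∀ {m n} → m ≤ n → w m ≤ w n
w-mono = monotone w w-suc

u≤ : ∀ n → u n ≤ n
u≤ n = +-cancelʳ-≤ 1 (u n) n
  (≤-trans (+-monoʳ-≤ (u n) (≤-trans (≤-reflexive (sym w-zero)) (w-mono {0} {n} z≤n))) (≤-reflexive (trans (u+w n) (+-comm 1 n))))

u-two : u 2 ≡ 2
u-two = trans (u-plus c-one) (cong suc u-one)

w< : ∀ n → 2 ≤ n → w n < n
w< n 2≤n = +-cancelˡ-≤ 1 _ _
  (≤-trans (+-monoˡ-≤ (w n) (≤-trans (≤-reflexive (sym u-two)) (u-mono {2} {n} 2≤n))) (≤-reflexive (u+w n)))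

c-plus : ∀ n → 1 ≤ n → c n ≡ true → c (suc n) ≡ not (c (u n))
c-plus n 1≤n e = c-plus-≤ 1≤n e (u≤ n)

c-minus : ∀ n → c n ≡ false → c (suc n) ≡ not (c (suc (w n)))
c-minus n e = c-minus-< (≤-trans (s≤s z≤n) 2≤n) e (w< n 2≤n)
  where
  2≤n : 2 ≤ n
  2≤n = minus⇒2≤ e

dichotomy : ∀ b → b ≡ true ⊎ b ≡ false
dichotomy true  = inj₁ refl
dichotomy false = inj₂ refl

true≢false : ∀ {b} → b ≡ true → b ≡ false → ⊥
true≢false refl ()

-- The invariant of the two pointers

-- The letters read by the two pointers move the pointers of the pointers in step.
record Plus (n : ℕ) : Set where
  field
    uu : u (u n) ≡ w (suc (w n))
    cw : 2 ≤ n → c (w n) ≡ false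

-- `cu` and `Plus.cw` remember how the current run of letters began: a run of - begins when `u` has
-- just stepped off a +, a later run of + when `w` has just stepped onto a -. The bound in `cw` sets
-- aside the initial run, where `w` still stands on a +.
record Minus (n : ℕ) : Set where
  field
    uu : u (u n) ≡ suc (w (suc (w n)))
    cu : ∃[ j ] u n ≡ suc j × c j ≡ true

Invariant : ℕ → Set
Invariant n = (c n ≡ true × Plus n) ⊎ (c n ≡ false × Minus n)

-- The excess of `u (u n)` over `w (suc (w n))` is 0 at a + and 1 at a -. A + read by `u` opens this
-- gap, a - read by `w` closes it, and the other two readings leave it alone; as the next letter
-- negates the one read, sign and gap change together.
invariant-suc : ∀ n → 1 ≤ n → Invariant n → Invariant (suc n)
invariant-suc n 1≤n (inj₁ (e , p)) with dichotomy (c (u n))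
... | inj₁ e′ = inj₂ (trans (c-plus n 1≤n e) (cong not e′) , record
  { uu = begin
      u (u (suc n))               ≡⟨ cong u (u-plus e) ⟩
      u (suc (u n))               ≡⟨ u-plus e′ ⟩
      suc (u (u n))               ≡⟨ cong suc (Plus.uu p) ⟩
      suc (w (suc (w n)))         ≡⟨ cong (λ k → suc (w (suc k))) (w-plus e) ⟨
      suc (w (suc (w (suc n))))   ∎
  ; cu = u n , u-plus e , e′ })
  where open ≡-Reasoning
... | inj₂ e′ = inj₁ (trans (c-plus n 1≤n e) (cong not e′) , record
  { uu = begin
      u (u (suc n))         ≡⟨ cong u (u-plus e) ⟩
      u (suc (u n))         ≡⟨ u-minus e′ ⟩
      u (u n)               ≡⟨ Plus.uu p ⟩
      w (suc (w n))         ≡⟨ cong (λ k → w (suc k)) (w-plus e) ⟨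
      w (suc (w (suc n)))   ∎
  ; cw = λ _ → trans (cong c (w-plus e)) (Plus.cw p (≤-trans (minus⇒2≤ e′) (u≤ n))) })
  where open ≡-Reasoning
invariant-suc n 1≤n (inj₂ (e , p)) with dichotomy (c (suc (w n)))
... | inj₁ e′ = inj₂ (trans (c-minus n e) (cong not e′) , record
  { uu = begin
      u (u (suc n))               ≡⟨ cong u (u-minus e) ⟩
      u (u n)                     ≡⟨ Minus.uu p ⟩
      suc (w (suc (w n)))         ≡⟨ cong suc (w-plus e′) ⟨
      suc (w (suc (suc (w n))))   ≡⟨ cong (λ k → suc (w (suc k))) (w-minus e) ⟨
      suc (w (suc (w (suc n))))   ∎
  ; cu = let j , eq , ej = Minus.cu p in j , trans (u-minus e) eq , ej })
  where open ≡-Reasoning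
... | inj₂ e′ = inj₁ (trans (c-minus n e) (cong not e′) , record
  { uu = begin
      u (u (suc n))             ≡⟨ cong u (u-minus e) ⟩
      u (u n)                   ≡⟨ Minus.uu p ⟩
      suc (w (suc (w n)))       ≡⟨ w-minus e′ ⟨
      w (suc (suc (w n)))       ≡⟨ cong (λ k → w (suc k)) (w-minus e) ⟨
      w (suc (w (suc n)))       ∎
  ; cw = λ _ → trans (cong c (w-minus e)) e′ })
  where open ≡-Reasoning

invariant : ∀ n → 1 ≤ n → Invariant n
invariant 1 _ = inj₁ (c-one , record
  { uu = trans (cong u u-one) (trans u-one (sym (trans (cong (λ k → w (suc k)) w-one) (trans (w-plus c-one) w-one))))
  ; cw = λ { (s≤s ()) } })
invariant (suc (suc n)) _ = invariant-suc (suc n) (s≤s z≤n) (invariant (suc n) (s≤s z≤n))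

plus : ∀ {n} → 1 ≤ n → c n ≡ true → Plus n
plus {n} 1≤n e with invariant n 1≤n
... | inj₁ (_ , p)  = p
... | inj₂ (e′ , _) = ⊥-elim (true≢false e e′)

minus : ∀ {n} → c n ≡ false → Minus n
minus {n} e with invariant n (≤-trans (s≤s z≤n) (minus⇒2≤ e))
... | inj₁ (e′ , _) = ⊥-elim (true≢false e′ e)
... | inj₂ (_ , p)  = p

-- Through the invariant, the next two equations restate u+w at u n and at suc (w n).
u-rec : ∀ n → 1 ≤ n → u (suc n) ≡ w (u n) + w (suc (w n))
u-rec n 1≤n with invariant n 1≤n
... | inj₁ (e , p) = trans (u-plus e) (trans (sym (u+w (u n)))
        (trans (+-comm (u (u n)) _) (cong (w (u n) +_) (Plus.uu p))))
... | inj₂ (e , p) = trans (u-minus e) (suc-injective (trans (sym (u+w (u n)))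
        (trans (+-comm (u (u n)) _) (trans (cong (w (u n) +_) (Minus.uu p)) (+-suc _ _)))))

w-rec : ∀ n → 1 ≤ n → 2 + w (suc n) ≡ u (u n) + u (suc (w n))
w-rec n 1≤n with invariant n 1≤n
... | inj₁ (e , p) = begin
  2 + w (suc n)                       ≡⟨ cong (2 +_) (w-plus e) ⟩
  suc (suc (w n))                     ≡⟨ u+w (suc (w n)) ⟨
  u (suc (w n)) + w (suc (w n))       ≡⟨ +-comm (u (suc (w n))) _ ⟩
  w (suc (w n)) + u (suc (w n))       ≡⟨ cong (_+ u (suc (w n))) (Plus.uu p) ⟨
  u (u n) + u (suc (w n))             ∎
  where open ≡-Reasoning
... | inj₂ (e , p) = begin
  2 + w (suc n)                         ≡⟨ cong (2 +_) (w-minus e) ⟩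
  suc (suc (suc (w n)))                 ≡⟨ cong suc (u+w (suc (w n))) ⟨
  suc (u (suc (w n)) + w (suc (w n)))   ≡⟨ cong suc (+-comm (u (suc (w n))) _) ⟩
  suc (w (suc (w n))) + u (suc (w n))   ≡⟨ cong (_+ u (suc (w n))) (Minus.uu p) ⟨
  u (u n) + u (suc (w n))               ∎
  where open ≡-Reasoning

-- Lattice points visited by the walk

split : ∀ {v p q} → suc v ≡ p + q → (u v ≡ p × w v ≡ q) ⊎ (u v < p × q < w v) ⊎ (p < u v × w v < q)
split {v} {p} {q} eq with <-cmp (u v) p
... | tri≈ _ refl _ = inj₁ (refl , +-cancelˡ-≡ (u v) (w v) q (trans (u+w v) eq))
... | tri< lt _ _ = inj₂ (inj₁ (lt , ≰⇒> λ le →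
        <-irrefl (trans (u+w v) eq) (+-mono-<-≤ lt le)))
... | tri> _ _ gt = inj₂ (inj₂ (gt , ≰⇒> λ le →
        <-irrefl (trans (sym eq) (sym (u+w v))) (+-mono-<-≤ gt le)))

record At (v p q : ℕ) (b : Bool) : Set where
  constructor at
  field
    u-at : u v ≡ p
    w-at : w v ≡ q
    c-at : c v ≡ b

open At public

-- The walk has one point on each antidiagonal, so missing `(p , q)` means erring in both
-- coordinates, in opposite directions. By monotonicity `u (u v)` is then too small or too large
-- against `w (suc (w v))`; where monotonicity falls one unit short, `cw` or `cu` supplies it. The -
-- at `q` makes `u p ≡ w (suc q)`, the equation of a +.
visit-plus : ∀ {p q v} → c q ≡ false → u p ≡ suc (w q) → suc v ≡ p + q → At v p q true
visit-plus {p} {q} {v} cq up eq with split {v} {p} {q} eq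
... | inj₂ (inj₁ (lt , gt)) = ⊥-elim bad
  where
  up≤ : u p ≤ w (w v)
  up≤ = ≤-trans (≤-reflexive (trans up (sym (w-minus cq)))) (w-mono gt)
  2≤v : 2 ≤ v
  2≤v = ≤-pred (≤-trans (+-mono-≤ {1} {p} {2} {q} (≤-trans (s≤s z≤n) lt) (minus⇒2≤ cq)) (≤-reflexive (sym eq)))
  bad : ⊥
  bad with invariant v (≤-trans (s≤s z≤n) 2≤v)
  ... | inj₁ (e , r) = 1+n≰n (≤-trans (≤-reflexive (sym (trans (Plus.uu r) (w-minus (Plus.cw r 2≤v)))))
                         (≤-trans (u-mono (<⇒≤ lt)) up≤))
  ... | inj₂ (e , r) = 1+n≰n (≤-trans (≤-reflexive (sym (Minus.uu r)))
                         (≤-trans (u-mono (<⇒≤ lt)) (≤-trans up≤ (w-suc (w v)))))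
... | inj₂ (inj₂ (gt , lt)) = ⊥-elim bad
  where
  1≤v : 1 ≤ v
  1≤v = ≤-trans (≤-trans (s≤s z≤n) gt) (u≤ v)
  bad : ⊥
  bad with invariant v 1≤v
  ... | inj₁ (e , r) = 1+n≰n (≤-trans (s≤s (w-mono lt)) (≤-trans (≤-reflexive (sym up))
                         (≤-trans (u-mono (<⇒≤ gt)) (≤-reflexive (Plus.uu r)))))
  ... | inj₂ (e , r) with Minus.cu r
  ...   | j , eq′ , cj = 1+n≰n (≤-trans (≤-reflexive (trans (sym (u-plus cj)) (trans (cong u (sym eq′)) (Minus.uu r))))
                           (≤-trans (s≤s (w-mono lt)) (≤-trans (≤-reflexive (sym up))
                             (u-mono (≤-pred (≤-trans gt (≤-reflexive eq′)))))))
visit-plus {p} {q} {v} cq up eq | inj₁ (refl , refl) = at refl refl cv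
  where
  cv : c v ≡ true
  cv with dichotomy (c v)
  ... | inj₁ e = e
  ... | inj₂ e = ⊥-elim (1+n≢n (sym (suc-injective (trans (sym up) (trans (Minus.uu (minus e)) (cong suc (w-minus cq)))))))

-- The counterpart of `visit-plus`: the + at `p` makes `u (suc p)` one more than `w (suc q)`, the
-- equation of a - at `(suc p , q)`.
visit-minus : ∀ {p q} → 1 ≤ p → 1 ≤ q → c p ≡ true → w (suc q) ≡ u p →
              At (p + q) (suc p) q false
visit-minus {p} {q} 1≤p 1≤q cp wq with split {p + q} {suc p} {q} refl
... | inj₂ (inj₁ (lt , gt)) = ⊥-elim bad
  where
  2≤v : 2 ≤ p + q
  2≤v = +-mono-≤ 1≤p 1≤q
  bad : ⊥
  bad with invariant (p + q) (≤-trans (s≤s z≤n) 2≤v)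
  ... | inj₁ (e , r) = 1+n≰n (≤-trans (s≤s (≤-trans (≤-reflexive (sym wq)) (w-mono gt)))
                         (≤-trans (≤-reflexive (sym (trans (Plus.uu r) (w-minus (Plus.cw r 2≤v))))) (u-mono (≤-pred lt))))
  ... | inj₂ (e , r) = 1+n≰n (≤-trans (s≤s (≤-trans (≤-reflexive (sym wq)) (w-mono (m≤n⇒m≤1+n gt))))
                         (≤-trans (≤-reflexive (sym (Minus.uu r))) (u-mono (≤-pred lt))))
... | inj₂ (inj₂ (gt , lt)) = ⊥-elim bad
  where
  bad : ⊥
  bad with invariant (p + q) (≤-trans 1≤p (m≤m+n p q))
  ... | inj₁ (e , r) = 1+n≰n (≤-trans (≤-reflexive (sym (u-plus cp))) (≤-trans (u-mono (<⇒≤ gt))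
                         (≤-trans (≤-reflexive (Plus.uu r)) (≤-trans (w-mono (m≤n⇒m≤1+n lt)) (≤-reflexive wq)))))
  ... | inj₂ (e , r) with Minus.cu r
  ...   | j , eq′ , cj = 1+n≰n (≤-trans (s≤s (≤-trans (≤-reflexive (sym (u-plus cp)))
                             (u-mono (≤-pred (≤-trans gt (≤-reflexive eq′))))))
                           (≤-trans (≤-reflexive (trans (sym (u-plus cj)) (trans (cong u (sym eq′)) (Minus.uu r))))
                             (s≤s (≤-trans (w-mono (m≤n⇒m≤1+n lt)) (≤-reflexive wq)))))
visit-minus {p} {q} 1≤p 1≤q cp wq | inj₁ (eu , ew) = at eu ew cv
  where
  cv : c (p + q) ≡ false
  cv with dichotomy (c (p + q))
  ... | inj₂ e = e
  ... | inj₁ e = ⊥-elim (1+n≢n (trans (sym (u-plus cp)) (trans (cong u (sym eu))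
                   (trans (Plus.uu (plus (≤-trans 1≤p (m≤m+n p q)) e)) (trans (cong (λ k → w (suc k)) ew) wq)))))

-- Places where the two pointers meet

-- In closed form `x t` is `(2 * 4 ^ t + 1) / 3`.
x₀ x : ℕ → ℕ
x₀ zero    = 0
x₀ (suc t) = 2 + 4 * x₀ t
x t = suc (x₀ t)

x-suc : ∀ t → suc (x (suc t)) ≡ (x t + x t) + (x t + x t)
x-suc t = eq (x₀ t)
  where
  eq : ∀ y → 4 + 4 * y ≡ (suc y + suc y) + (suc y + suc y)
  eq = solve-∀

at-twice : ∀ {y} → 1 ≤ y → c y ≡ true → u y ≡ w y → At (y + y) (suc y) y false
at-twice 1≤y e eq = visit-minus 1≤y 1≤y e (trans (w-plus e) (sym eq))

-- A ladder: the meeting at time `x t` feeds `visit-minus` with `p = q = x t`; the - found at time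
-- `2 * x t` feeds `visit-plus` with both coordinates `2 * x t`, which gives the next meeting.
at-2x    : ∀ t → At (x t + x t) (suc (x t)) (x t) false
at-x-suc : ∀ t → At (x (suc t)) (x t + x t) (x t + x t) true

at-2x zero    = at-twice ≤-refl c-one (trans u-one (sym w-one))
at-2x (suc t) = at-twice (s≤s z≤n) (c-at m) (trans (u-at m) (sym (w-at m)))
  where
  m : At (x (suc t)) (x t + x t) (x t + x t) true
  m = at-x-suc t

at-x-suc t = visit-plus (c-at d) (trans (u-at d) (cong suc (sym (w-at d)))) (x-suc t)
  where
  d : At (x t + x t) (suc (x t)) (x t) false
  d = at-2x t

-- The position of the powers of four

E : ℕ → ℕ → ℕ
E zero    _       = 0
E (suc k) zero    = 0
E (suc k) (suc i) = suc (E k i + 2 * E k (suc i) + E k (suc (suc i)))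

-- Points at equal distances to the left and to the right of 4 ^ k (le, re) and of 2 * 4 ^ k (lo, ro).
re ro le lo : ℕ → ℕ → ℕ
re k i = 4 ^ k + E k i
ro k i = suc (re k i + re k (suc i))

-- Defined without subtraction; see le+E.
le₀ : ℕ → ℕ → ℕ
le₀ zero    _       = 0
le₀ (suc k) zero    = suc (le₀ k 0 + le₀ k 1) + (re k 0 + re k 1)
le₀ (suc k) (suc i) = suc (le₀ k i + le₀ k (suc i)) + suc (le₀ k (suc i) + le₀ k (suc (suc i)))
le k i = suc (le₀ k i)
lo k i = suc (le₀ k i + le₀ k (suc i))

le+E : ∀ k i → le k i + E k i ≡ 4 ^ k
le+E zero    _ = refl
le+E (suc k) zero = begin
  le (suc k) 0 + 0                                      ≡⟨ eq (le₀ k 0) (le₀ k 1) (4 ^ k) (E k 0) (E k 1) ⟩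
  (le k 0 + E k 0) + (le k 1 + E k 1) + 2 * 4 ^ k       ≡⟨ cong₂ (λ a b → a + b + 2 * 4 ^ k) (le+E k 0) (le+E k 1) ⟩
  4 ^ k + 4 ^ k + 2 * 4 ^ k                             ≡⟨ four (4 ^ k) ⟩
  4 ^ suc k                                             ∎
  where
  open ≡-Reasoning
  eq : ∀ a b n e f → suc (suc (a + b) + ((n + e) + (n + f))) + 0 ≡ (suc a + e) + (suc b + f) + 2 * n
  eq = solve-∀
  four : ∀ n → n + n + 2 * n ≡ 4 * n
  four = solve-∀
le+E (suc k) (suc i) = begin
  le (suc k) (suc i) + E (suc k) (suc i)
    ≡⟨ eq (le₀ k i) (le₀ k (suc i)) (le₀ k (2 + i)) (E k i) (E k (suc i)) (E k (2 + i)) ⟩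
  (le k i + E k i) + 2 * (le k (suc i) + E k (suc i)) + (le k (2 + i) + E k (2 + i))
    ≡⟨ cong₂ (λ a b → a + 2 * b + (le k (2 + i) + E k (2 + i))) (le+E k i) (le+E k (suc i)) ⟩
  4 ^ k + 2 * 4 ^ k + (le k (2 + i) + E k (2 + i))
    ≡⟨ cong (4 ^ k + 2 * 4 ^ k +_) (le+E k (2 + i)) ⟩
  4 ^ k + 2 * 4 ^ k + 4 ^ k    ≡⟨ four (4 ^ k) ⟩
  4 ^ suc k                    ∎
  where
  open ≡-Reasoning
  eq : ∀ a b c e f g → suc (suc (a + b) + suc (b + c)) + suc (e + 2 * f + g) ≡ (suc a + e) + 2 * (suc b + f) + (suc c + g)
  eq = solve-∀
  four : ∀ n → n + 2 * n + n ≡ 4 * n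
  four = solve-∀

re≡le : ∀ k → re k 0 ≡ le k 0
re≡le zero    = refl
re≡le (suc k) = trans (+-identityʳ _) (trans (sym (le+E (suc k) 0)) (+-identityʳ _))

-- `Even k` describes times near the even power `4 ^ suc k` of two, `Odd k` times near the odd power
-- `2 * 4 ^ k`. Up to one, the coordinates belong to the families around half that power.
record Even (k : ℕ) : Set where
  field
    centre  : At (le (suc k) 0) (ro k 0) (suc (lo k 0)) true
    left    : ∀ i → At (le (suc k) (suc i)) (suc (lo k i)) (suc (lo k (suc i))) true
    right   : ∀ i → At (re (suc k) (suc i)) (suc (ro k (suc i))) (re k i + re k (suc i)) false
    c-right : ∀ i → c (suc (re (suc k) (suc i))) ≡ false

record Odd (k : ℕ) : Set where
  field
    left   : ∀ i → At (lo k i) (suc (le k (suc i))) (le₀ k i) false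
    c-left : ∀ i → c (suc (lo k i)) ≡ false
    right  : ∀ i → At (ro k i) (suc (re k i)) (suc (re k (suc i))) true

minus-minus : ∀ {v p q} → At v p q false → c (suc q) ≡ true → c (suc v) ≡ false
minus-minus {v} (at _ refl e) e′ = trans (c-minus v e) (cong not e′)

-- The visit criteria involve the walk at the two coordinates only, so known times produce times
-- twice as large. Neighbours `i` and `suc i` of a family qualify as coordinates because, up to one,
-- the `u` of the one is the `w` of the other. Adding neighbours is one application of Pascal's
-- rule; two such steps make up the recursion of `E`.
even⇒odd : ∀ k → Even k → Odd (suc k)
even⇒odd k ev = record
  { left   = left′
  ; c-left = λ i → minus-minus (left′ i) (c-le i)
  ; right  = λ i → visit-plus (c-right i)
      (trans (u-re i) (cong suc (sym (trans (w-minus (c-at (right i))) (cong suc (w-at (right i)))))))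
      (cong suc (sym (+-suc (re (suc k) i) (re (suc k) (suc i)))))
  }
  where
  open Even ev
  c-le : ∀ i → c (le (suc k) i) ≡ true
  c-le zero    = c-at centre
  c-le (suc i) = c-at (left i)
  w-le : ∀ i → w (le (suc k) i) ≡ suc (lo k i)
  w-le zero    = w-at centre
  w-le (suc i) = w-at (left i)
  1≤le₀ : ∀ i → 1 ≤ le₀ (suc k) i
  1≤le₀ zero    = s≤s z≤n
  1≤le₀ (suc i) = s≤s z≤n
  lo-sum : ∀ i → le (suc k) (suc i) + le₀ (suc k) i ≡ lo (suc k) i
  lo-sum i = cong suc (+-comm (le₀ (suc k) (suc i)) (le₀ (suc k) i))
  left′ : ∀ i → At (lo (suc k) i) (suc (le (suc k) (suc i))) (le₀ (suc k) i) false
  left′ i = subst (λ v → At v (suc (le (suc k) (suc i))) (le₀ (suc k) i) false) (lo-sum i)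
    (visit-minus (s≤s z≤n) (1≤le₀ i) (c-at (left i)) (trans (w-le i) (sym (u-at (left i)))))
  u-re : ∀ i → u (suc (re (suc k) i)) ≡ suc (ro k i)
  -- The centre carries a +, the points to its right a -; the advance of `u` at the centre makes the
  -- formula uniform in `i`.
  u-re zero    = trans (cong (λ v → u (suc v)) (re≡le (suc k)))
                   (trans (u-plus (c-at centre)) (cong suc (u-at centre)))
  u-re (suc i) = trans (u-minus (c-at (right i))) (u-at (right i))

odd⇒even : ∀ k → Odd k → Even k
odd⇒even k od = record
  -- The two families join here: the coordinates lie on either side of `2 * 4 ^ k`, and
  -- `re k 0 ≡ le k 0` matches the `u` on the right with the `w` on the left.
  { centre  = visit-plus (c-left 0) (trans (u-at (right 0)) (cong suc (trans (re≡le k) (sym (w-lo 0)))))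
                (centre-sum (le₀ k 0 + le₀ k 1) (re k 0 + re k 1))
  ; left    = λ i → visit-plus (c-left (suc i))
                (trans (u-lo i) (cong suc (sym (w-lo (suc i)))))
                (cong suc (sym (+-suc (lo k i) (lo k (suc i)))))
  ; right   = right′
  ; c-right = λ i → minus-minus (right′ i) (c-at (right i))
  }
  where
  open Odd od
  w-lo : ∀ i → w (suc (lo k i)) ≡ le k i
  w-lo i = trans (w-minus (c-at (left i))) (cong suc (w-at (left i)))
  u-lo : ∀ i → u (suc (lo k i)) ≡ suc (le k (suc i))
  u-lo i = trans (u-minus (c-at (left i))) (u-at (left i))
  centre-sum : ∀ a b → suc (suc (suc a + b)) ≡ suc b + suc (suc a)
  centre-sum = solve-∀
  right-sum : ∀ n e f g → suc ((n + f) + (n + g)) + ((n + e) + (n + f)) ≡ 4 * n + suc (e + 2 * f + g)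
  right-sum = solve-∀
  1≤re : ∀ i → 1 ≤ re k i + re k (suc i)
  1≤re i = ≤-trans (m^n>0 4 k) (≤-trans (m≤m+n (4 ^ k) (E k i)) (m≤m+n (re k i) (re k (suc i))))
  right′ : ∀ i → At (re (suc k) (suc i)) (suc (ro k (suc i))) (re k i + re k (suc i)) false
  right′ i = subst (λ v → At v (suc (ro k (suc i))) (re k i + re k (suc i)) false)
    (right-sum (4 ^ k) (E k i) (E k (suc i)) (E k (2 + i)))
    (visit-minus (s≤s z≤n) (1≤re i) (c-at (right (suc i))) (trans (w-at (right i)) (sym (u-at (right (suc i))))))

step-plus : ∀ {v p q} → 1 ≤ v → At v p q true → At (suc v) (suc p) q (not (c p))
step-plus {v} 1≤v (at refl refl e) = at (u-plus e) (w-plus e) (c-plus v 1≤v e)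

even : ∀ k → Even k
-- All distances `E 1 (suc i)` are 1, so the families collapse to the times 3, 4 and 5, with the
-- letter at 6 for `c-right`.
even zero = record
  { centre  = at₄
  ; left    = λ _ → at-x-suc 0
  ; right   = λ _ → subst (At 5 4 2) (cong not (c-at (at-x-suc 0))) (step-plus (s≤s z≤n) at₄)
  ; c-right = λ _ → c-at (at-2x 1)
  }
  where
  at₄ : At 4 3 2 true
  at₄ = subst (At 4 3 2) (cong not (c-at (at-2x 0))) (step-plus (s≤s z≤n) (at-x-suc 0))
even (suc k) = odd⇒even (suc k) (even⇒odd k (even k))

le-0 : ∀ k → le k 0 ≡ 4 ^ k
le-0 zero    = refl
le-0 (suc k) = trans (sym (+-identityʳ _)) (le+E (suc k) 0)

-- At time `y` the counter `u` leaves `4 ^ suc k`; since `suc (A m)` is a value of `u`, this is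
-- where `A` rises to `4 ^ suc k`. The time in `minus-at-4^` is the one at which `w` is about to
-- enter `4 ^ suc k`.
plus-at-4^ : ∀ k {y} → suc y ≡ 4 ^ suc k + re (suc k) 1 → At y (4 ^ suc k) (re (suc k) 1) true
plus-at-4^ k eq = visit-plus (c-at (right 0))
  (trans (cong u (sym (le-0 (suc k)))) (trans (u-at centre) (cong suc (sym (w-at (right 0)))))) eq
  where open Even (even k)

minus-at-4^ : ∀ k → At (lo (suc k) 0) (suc (le (suc k) 1)) (le₀ (suc k) 0) false
minus-at-4^ k = Odd.left (even⇒odd k (even k)) 0

-- Binomial sums as increments of the distances

S : ℕ → ℕ → ℕ
S k zero    = 0
S k (suc i) = S k i + (suc (k + k) C suc (k + i))

S-zero : ∀ i → S 0 (suc i) ≡ 1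
S-zero zero    = refl
S-zero (suc i) = trans (+-identityʳ _) (S-zero i)

C-middle : ∀ k → (suc (k + k) C k) ≡ (suc (k + k) C suc k)
C-middle k = trans (nCk≡nC[n∸k] {k} (≤-trans (m≤m+n k k) (n≤1+n _)))
  (cong (suc (k + k) C_) (m+n∸n≡m (suc k) k))

C-twice : ∀ n j → (suc (suc n) C suc (suc j)) ≡ (n C j) + 2 * (n C suc j) + (n C suc (suc j))
C-twice n j = begin
  (suc (suc n) C suc (suc j))                                 ≡⟨ nCk+nC[k+1]≡[n+1]C[k+1] (suc n) (suc j) ⟨
  (suc n C suc j) + (suc n C suc (suc j))                       ≡⟨ cong₂ _+_ (nCk+nC[k+1]≡[n+1]C[k+1] n j) (nCk+nC[k+1]≡[n+1]C[k+1] n (suc j)) ⟨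
  (n C j) + (n C suc j) + ((n C suc j) + (n C suc (suc j)))         ≡⟨ arith (n C j) (n C suc j) (n C suc (suc j)) ⟩
  (n C j) + 2 * (n C suc j) + (n C suc (suc j))                   ∎
  where
  open ≡-Reasoning
  arith : ∀ a b c → a + b + (b + c) ≡ a + 2 * b + c
  arith = solve-∀

-- `S k i` adds up the first `i` entries of the right half of row `2 * k + 1` of Pascal's triangle,
-- so passing to `suc k` applies Pascal's rule twice. This is the recursion of `E` without its
-- constant.
S-suc : ∀ k i → S (suc k) (suc i) ≡ S k i + 2 * S k (suc i) + S k (suc (suc i))
S-suc k zero = begin
  (suc (suc k + suc k) C suc (suc k + 0))           ≡⟨ cong₂ (λ a b → (suc a C suc b)) (cong suc (+-suc k k)) (+-identityʳ (suc k)) ⟩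
  (suc (suc n) C suc (suc k))                       ≡⟨ C-twice n k ⟩
  -- The left middle entry lies outside the right half; the symmetry of the row folds it onto the
  -- right one.
  (n C k) + 2 * (n C suc k) + (n C suc (suc k))         ≡⟨ cong (λ a → a + 2 * (n C suc k) + (n C suc (suc k))) (C-middle k) ⟩
  (n C suc k) + 2 * (n C suc k) + (n C suc (suc k))     ≡⟨ arith (n C suc k) (n C suc (suc k)) ⟩
  2 * (n C suc k) + ((n C suc k) + (n C suc (suc k)))   ≡⟨ cong₂ (λ a b → 2 * (n C suc a) + ((n C suc a) + (n C suc b))) (+-identityʳ k) (+-comm k 1) ⟨
  2 * S k 1 + S k 2                               ∎
  where
  open ≡-Reasoning
  n : ℕ
  n = suc (k + k)
  arith : ∀ a b → a + 2 * a + b ≡ 2 * a + (a + b)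
  arith = solve-∀
S-suc k (suc i) = begin
  S (suc k) (suc i) + (suc (suc k + suc k) C suc (suc k + suc i))
    ≡⟨ cong₂ _+_ (S-suc k i) (trans (cong₂ (λ a b → (suc a C suc b)) (cong suc (+-suc k k)) (cong suc (+-suc k i))) (C-twice n (suc (k + i)))) ⟩
  S k i + 2 * S k (suc i) + S k (suc (suc i)) + ((n C suc (k + i)) + 2 * (n C suc (suc (k + i))) + (n C suc (suc (suc (k + i)))))
    ≡⟨ arith (S k i) (S k (suc i)) (S k (suc (suc i))) (n C suc (k + i)) (n C suc (suc (k + i))) (n C suc (suc (suc (k + i)))) ⟩
  S k (suc i) + 2 * (S k (suc i) + (n C suc (suc (k + i)))) + (S k (suc (suc i)) + (n C suc (suc (suc (k + i)))))
    ≡⟨ cong₂ (λ a b → S k (suc i) + 2 * (S k (suc i) + (n C suc a)) + (S k (suc (suc i)) + (n C suc b))) (+-suc k i) (trans (+-suc k (suc i)) (cong suc (+-suc k i))) ⟨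
  S k (suc i) + 2 * S k (suc (suc i)) + S k (suc (suc (suc i)))   ∎
  where
  open ≡-Reasoning
  n : ℕ
  n = suc (k + k)
  arith : ∀ s t r a b c → s + 2 * t + r + (a + 2 * b + c) ≡ (s + a) + 2 * (t + b) + (r + c)
  arith = solve-∀

-- The constant in the recursion of `E` cancels from the difference of two consecutive levels, which
-- therefore obeys the recursion of `S`, with the same start.
E-suc : ∀ k i → E (suc k) i ≡ E k i + S k i
E-suc zero    zero    = refl
E-suc zero    (suc i) = sym (S-zero i)
E-suc (suc k) zero    = refl
E-suc (suc k) (suc i) = begin
  suc (E (suc k) i + 2 * E (suc k) (suc i) + E (suc k) (2 + i))
    ≡⟨ cong suc (cong₂ _+_ (cong₂ (λ a b → a + 2 * b) (E-suc k i) (E-suc k (suc i))) (E-suc k (2 + i))) ⟩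
  suc ((E k i + S k i) + 2 * (E k (suc i) + S k (suc i)) + (E k (2 + i) + S k (2 + i)))
    ≡⟨ arith (E k i) (E k (suc i)) (E k (2 + i)) (S k i) (S k (suc i)) (S k (2 + i)) ⟩
  E (suc k) (suc i) + (S k i + 2 * S k (suc i) + S k (2 + i))
    ≡⟨ cong (E (suc k) (suc i) +_) (S-suc k i) ⟨
  E (suc k) (suc i) + S (suc k) (suc i)   ∎
  where
  open ≡-Reasoning
  arith : ∀ a b c s t r → suc ((a + s) + 2 * (b + t) + (c + r)) ≡ suc (a + 2 * b + c) + (s + 2 * t + r)
  arith = solve-∀

-- `S k 1` is one of the two equal middle entries of row `2 * k + 1`, and these add up to the
-- central entry of the next row.
E-increment : ∀ k → 2 * E (suc k) 1 ≡ 2 * E k 1 + ((2 * k + 2) C (k + 1))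
E-increment k = begin
  2 * E (suc k) 1                          ≡⟨ cong (2 *_) (E-suc k 1) ⟩
  2 * (E k 1 + (n C suc (k + 0)))            ≡⟨ arith (E k 1) (n C suc (k + 0)) ⟩
  2 * E k 1 + ((n C suc (k + 0)) + (n C suc (k + 0)))
    ≡⟨ cong (λ j → 2 * E k 1 + ((n C suc j) + (n C suc j))) (+-identityʳ k) ⟩
  2 * E k 1 + ((n C suc k) + (n C suc k))      ≡⟨ cong (λ a → 2 * E k 1 + (a + (n C suc k))) (C-middle k) ⟨
  2 * E k 1 + ((n C k) + (n C suc k))          ≡⟨ cong (2 * E k 1 +_) (nCk+nC[k+1]≡[n+1]C[k+1] n k) ⟩
  2 * E k 1 + (suc n C suc k)                ≡⟨ cong₂ (λ a b → 2 * E k 1 + (a C b)) (double k) (+-comm 1 k) ⟩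
  2 * E k 1 + ((2 * k + 2) C (k + 1))        ∎
  where
  open ≡-Reasoning
  n : ℕ
  n = suc (k + k)
  arith : ∀ a b → 2 * (a + b) ≡ 2 * a + (b + b)
  arith = solve-∀
  double : ∀ k → suc (suc (k + k)) ≡ 2 * k + 2
  double = solve-∀

-- The recurrence of Q̃ in terms of A and B

Qtab-suc : ∀ n {i} → i ≤ n → Qtab (suc n) i ≡ Qtab n i
Qtab-suc n {i} i≤n with i ≟ suc n
... | yes refl = ⊥-elim (1+n≰n i≤n)
... | no _     = refl

Qtab-stable : ∀ {n i} → i ≤′ n → Qtab n i ≡ Qt i
Qtab-stable ≤′-refl       = refl
Qtab-stable (≤′-step i≤n) = trans (Qtab-suc _ (≤′⇒≤ i≤n)) (Qtab-stable i≤n)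

Qt-suc : ∀ n → let s = Qtab (2 + n) (3 + n ∸ Qt (2 + n)) + Qtab (2 + n) (3 + n ∸ Qtab (2 + n) (1 + n)) in
         Qt (3 + n) ≡ (if isEven (1 + n) then s + 1 else s ∸ 1)
Qt-suc n with 3 + n ≟ 3 + n
... | yes _ = refl
... | no ne = ⊥-elim (ne refl)

Qt-rec : ∀ n {i j} → 2 ≤ n → i + Qt n ≡ suc n → j + Qt (n ∸ 1) ≡ suc n → i ≤ n → j ≤ n →
         Qt (suc n) ≡ (if isEven (suc n) then Qt i + Qt j + 1 else Qt i + Qt j ∸ 1)
Qt-rec (suc zero) (s≤s ())
Qt-rec (suc (suc n)) {i} {j} _ ei ej i≤ j≤ =
  trans (Qt-suc n) (cong (λ s → if isEven (1 + n) then s + 1 else s ∸ 1) (cong₂ _+_ left right))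
  where
  left : Qtab (2 + n) (3 + n ∸ Qt (2 + n)) ≡ Qt i
  left = trans (cong (Qtab (2 + n)) (trans (cong (_∸ Qt (2 + n)) (sym ei)) (m+n∸n≡m i (Qt (2 + n))))) (Qtab-stable (≤⇒≤′ i≤))
  right : Qtab (2 + n) (3 + n ∸ Qtab (2 + n) (1 + n)) ≡ Qt j
  right = trans (cong (λ q → Qtab (2 + n) (3 + n ∸ q)) (Qtab-suc (1 + n) ≤-refl))
    (trans (cong (Qtab (2 + n)) (trans (cong (_∸ Qt (1 + n)) (sym ej)) (m+n∸n≡m j (Qt (1 + n))))) (Qtab-stable (≤⇒≤′ j≤)))

isEven-+2 : ∀ m n → isEven (m + m + n) ≡ isEven n
isEven-+2 zero    n = refl
isEven-+2 (suc m) n rewrite +-suc m m = isEven-+2 m n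

-- Stands for `Qt n = 2 a − 1`. Oddness is carried along with the half, since the floor in `A` and
-- `B` alone does not determine Q̃.
record OddAt (n a : ℕ) : Set where
  constructor odd
  field is-odd : suc (Qt n) ≡ a + a

open OddAt

half : ∀ {q a} → suc q ≡ a + a → ⌊ (q + 1) /2⌋ ≡ a
half {q} {a} eq = trans (cong ⌊_/2⌋ (trans (+-comm q 1) eq)) (sym (n≡⌊n+n/2⌋ a))

odd⇒1≤ : ∀ {n a} → OddAt n a → 1 ≤ a
odd⇒1≤ {a = suc a} _ = s≤s z≤n
odd⇒1≤ {a = zero} (odd ())

suc∸1 : ∀ m → 2 * suc m ∸ 1 ≡ suc (m + m)
suc∸1 m = trans (cong (m +_) (cong suc (+-identityʳ m))) (+-suc m m)

2*≡ : ∀ m → 2 * m ≡ m + m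
2*≡ m = cong (m +_) (+-identityʳ m)

-- A(m) and B(m) are read off from Q̃(2m − 1) = 2 A(m) − 1 and Q̃(2m) = 2 B(m) − 1.
OddA OddB : ℕ → Set
OddA m = OddAt (2 * m ∸ 1) (A m)
OddB m = OddAt (2 * m) (B m)

A-intro : ∀ {m a} → OddAt (2 * m ∸ 1) a → OddA m × A m ≡ a
A-intro {m} {a} o = odd (trans (is-odd o) (cong₂ _+_ (sym e) (sym e))) , e
  where
  e : A m ≡ a
  e = half (is-odd o)

B-intro : ∀ {m a} → OddAt (2 * m) a → OddB m × B m ≡ a
B-intro {m} {a} o = odd (trans (is-odd o) (cong₂ _+_ (sym e) (sym e))) , e
  where
  e : B m ≡ a
  e = half (is-odd o)

pointer-≤ : ∀ {i a m} → i + a ≡ suc m → 1 ≤ a → i ≤ m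
pointer-≤ {i} {suc a} {m} eq _ = ≤-trans (m≤m+n i a) (≤-reflexive (suc-injective (trans (sym (+-suc i a)) eq)))

pointer-even : ∀ i a m q → i + a ≡ suc m → suc q ≡ a + a → (i + i) + q ≡ suc (m + m)
pointer-even i a m q eq o = suc-injective (begin
  suc (i + i + q)     ≡⟨ +-suc (i + i) q ⟨
  i + i + suc q       ≡⟨ cong (i + i +_) o ⟩
  i + i + (a + a)     ≡⟨ swap i a ⟩
  (i + a) + (i + a)   ≡⟨ cong₂ _+_ eq eq ⟩
  suc m + suc m       ≡⟨ cong suc (+-suc m m) ⟩
  suc (suc (m + m))   ∎)
  where
  open ≡-Reasoning
  swap : ∀ i a → i + i + (a + a) ≡ (i + a) + (i + a)
  swap = solve-∀

-- An odd index less an odd value is even, so both arguments of Q̃ are even and only `B` is read.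
-- After halving, the summand -1 leaves `B i + B j − 1`.
A-step : ∀ {m i j} → 1 ≤ m → OddB m → OddA m → i + B m ≡ suc m → j + A m ≡ suc m → OddB i → OddB j →
         OddA (suc m) × suc (A (suc m)) ≡ B i + B j
A-step {suc m′} {i} {j} _ ob oa ei ej oi oj = proj₁ r , trans (cong suc (proj₂ r)) (sum oi oj)
  where
  m = suc m′
  oi′ : OddAt (i + i) (B i)
  oi′ = subst (λ n → OddAt n (B i)) (2*≡ i) oi
  oj′ : OddAt (j + j) (B j)
  oj′ = subst (λ n → OddAt n (B j)) (2*≡ j) oj
  ob′ : OddAt (m + m) (B m)
  ob′ = subst (λ n → OddAt n (B m)) (2*≡ m) ob
  oa′ : OddAt (m + m ∸ 1) (A m)
  oa′ = subst (λ n → OddAt (n ∸ 1) (A m)) (2*≡ m) oa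
  i≤m : i ≤ m
  i≤m = pointer-≤ ei (odd⇒1≤ ob)
  j≤m : j ≤ m
  j≤m = pointer-≤ ej (odd⇒1≤ oa)
  rec : Qt (suc (m + m)) ≡ Qt (i + i) + Qt (j + j) ∸ 1
  rec = trans (Qt-rec (m + m) {i + i} {j + j} (+-mono-≤ (s≤s z≤n) (s≤s z≤n)) (pointer-even i (B m) m _ ei (is-odd ob′)) (pointer-even j (A m) m _ ej (is-odd oa′))
                 (+-mono-≤ i≤m i≤m) (+-mono-≤ j≤m j≤m))
          (cong (λ b → if b then Qt (i + i) + Qt (j + j) + 1 else Qt (i + i) + Qt (j + j) ∸ 1)
            (trans (cong isEven (+-comm 1 (m + m))) (isEven-+2 m 1)))
  sum : OddB i → OddB j → suc (pred (B i) + B j) ≡ B i + B j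
  sum oi _ = cong (_+ B j) (suc-pred (B i) {{>-nonZero (odd⇒1≤ oi)}})
  odd-sum : ∀ q q′ b b′ → suc q ≡ b + b → suc q′ ≡ b′ + b′ →
            suc (q + q′ ∸ 1) ≡ (pred b + b′) + (pred b + b′)
  odd-sum q q′ (suc b) (suc b′) e e′ rewrite suc-injective e | suc-injective e′ = arith b b′
    where
    arith : ∀ b b′ → suc ((b + suc b) + (b′ + suc b′) ∸ 1) ≡ (b + suc b′) + (b + suc b′)
    arith b b′ rewrite +-suc b b = lem b b′
      where
      lem : ∀ b b′ → suc ((b + b) + (b′ + suc b′)) ≡ (b + suc b′) + (b + suc b′)
      lem = solve-∀
  r : OddA (suc m) × A (suc m) ≡ pred (B i) + B j
  r = A-intro {suc m} (subst (λ n → OddAt n (pred (B i) + B j)) (sym (suc∸1 m))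
        (odd (trans (cong suc rec) (odd-sum (Qt (i + i)) (Qt (j + j)) (B i) (B j) (is-odd oi′) (is-odd oj′)))))

pointer-odd : ∀ i a m q → 1 ≤ i → i + a ≡ suc m → suc q ≡ a + a → (i + i ∸ 1) + q ≡ m + m
pointer-odd (suc i) a m q _ eq o =
  suc-injective (pointer-even (suc i) a m q eq o)

-- An even index less an odd value is odd, so only `A` is read; the summand +1 cancels one of the
-- two offsets -1, and the halves add up exactly.
B-step : ∀ {m i j} → 1 ≤ m → OddA (suc m) → OddB m → i + A (suc m) ≡ suc (suc m) → j + B m ≡ suc (suc m) →
         1 ≤ i → 1 ≤ j → OddA i → OddA j → OddB (suc m) × B (suc m) ≡ A i + A j
B-step {m} {i} {j} 1≤m oa ob ei ej 1≤i 1≤j oi oj =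
  B-intro {suc m} (subst (λ n → OddAt n (A i + A j)) (sym (trans (2*≡ (suc m)) (cong suc (+-suc m m))))
    (odd (trans (cong suc rec) (odd-sum (Qt (i + i ∸ 1)) (Qt (j + j ∸ 1)) (A i) (A j) (is-odd oi′) (is-odd oj′)))))
  where
  oi′ : OddAt (i + i ∸ 1) (A i)
  oi′ = subst (λ n → OddAt (n ∸ 1) (A i)) (2*≡ i) oi
  oj′ : OddAt (j + j ∸ 1) (A j)
  oj′ = subst (λ n → OddAt (n ∸ 1) (A j)) (2*≡ j) oj
  oa′ : OddAt (suc (m + m)) (A (suc m))
  oa′ = subst (λ n → OddAt n (A (suc m))) (suc∸1 m) oa
  ob′ : OddAt (m + m) (B m)
  ob′ = subst (λ n → OddAt n (B m)) (2*≡ m) ob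
  bound : ∀ {i a} → i + a ≡ suc (suc m) → 1 ≤ a → i + i ∸ 1 ≤ suc (m + m)
  bound {i} eq 1≤a = ∸-monoˡ-≤ 1 (≤-trans (+-mono-≤ i≤ i≤) (≤-reflexive (cong suc (+-suc m m))))
    where
    i≤ : i ≤ suc m
    i≤ = pointer-≤ eq 1≤a
  rec : Qt (suc (suc (m + m))) ≡ Qt (i + i ∸ 1) + Qt (j + j ∸ 1) + 1
  rec = trans (Qt-rec (suc (m + m)) {i + i ∸ 1} {j + j ∸ 1} (s≤s (≤-trans 1≤m (m≤m+n m m)))
                 (trans (pointer-odd i (A (suc m)) (suc m) _ 1≤i ei (is-odd oa′)) (cong suc (+-suc m m)))
                 (trans (pointer-odd j (B m) (suc m) _ 1≤j ej (is-odd ob′)) (cong suc (+-suc m m)))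
                 (bound ei (odd⇒1≤ oa)) (bound ej (odd⇒1≤ ob)))
          (cong (λ b → if b then Qt (i + i ∸ 1) + Qt (j + j ∸ 1) + 1 else Qt (i + i ∸ 1) + Qt (j + j ∸ 1) ∸ 1)
            (trans (cong isEven (sym (+-identityʳ (m + m)))) (isEven-+2 m 0)))
  odd-sum : ∀ q q′ b b′ → suc q ≡ b + b → suc q′ ≡ b′ + b′ → suc (q + q′ + 1) ≡ (b + b′) + (b + b′)
  odd-sum q q′ b b′ e e′ = trans (shift q q′) (trans (cong₂ _+_ e e′) (swap b b′))
    where
    shift : ∀ q q′ → suc (q + q′ + 1) ≡ suc q + suc q′
    shift = solve-∀
    swap : ∀ b b′ → (b + b) + (b′ + b′) ≡ (b + b′) + (b + b′)
    swap = solve-∀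

-- A and B read off from the walk

2x<x-suc : ∀ t → x t + x t < x (suc t)
2x<x-suc t = ≤-trans (m≤m+n _ (x₀ t + x₀ t)) (≤-reflexive (eq (x₀ t)))
  where
  eq : ∀ y → suc (suc y + suc y) + (y + y) ≡ 3 + 4 * y
  eq = solve-∀

x<x-suc : ∀ t → x t < x (suc t)
x<x-suc t = ≤-<-trans (m≤m+n (x t) (x t)) (2x<x-suc t)

x<2x : ∀ t → x t < x t + x t
x<2x t = s≤s (m≤n+m (suc (x₀ t)) (x₀ t))

t<x : ∀ t → t < x t
t<x zero    = s≤s z≤n
t<x (suc t) = ≤-<-trans (t<x t) (x<x-suc t)

u-past-diagonal : ∀ t {v} → x (suc t) < v → suc (x t + x t) ≤ u v
u-past-diagonal t lt = ≤-trans (≤-reflexive (sym (trans (u-plus (c-at (at-x-suc t))) (cong suc (u-at (at-x-suc t)))))) (u-mono lt)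

u-upto-diagonal : ∀ t {v} → v ≤ x (suc t) → u v ≤ x t + x t
u-upto-diagonal t le = ≤-trans (u-mono le) (≤-reflexive (u-at (at-x-suc t)))

w-from-diagonal : ∀ t {v} → x (suc t) ≤ v → x t + x t ≤ w v
w-from-diagonal t le = ≤-trans (≤-reflexive (sym (w-at (at-x-suc t)))) (w-mono le)

w-upto-diagonal : ∀ t {v} → v ≤ x (suc t) → w v ≤ x t + x t
w-upto-diagonal t le = ≤-trans (w-mono le) (≤-reflexive (w-at (at-x-suc t)))

u-from-2x : ∀ t {v} → x t + x t ≤ v → suc (x t) ≤ u v
u-from-2x t le = ≤-trans (≤-reflexive (sym (u-at (at-2x t)))) (u-mono le)

u-upto-2x : ∀ t {v} → v ≤ x t + x t → u v ≤ suc (x t)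
u-upto-2x t le = ≤-trans (u-mono le) (≤-reflexive (u-at (at-2x t)))

w-from-2x : ∀ t {v} → x t + x t ≤ v → x t ≤ w v
w-from-2x t le = ≤-trans (≤-reflexive (sym (w-at (at-2x t)))) (w-mono le)

w-upto-2x : ∀ t {v} → v ≤ x t + x t → w v ≤ x t
w-upto-2x t le = ≤-trans (w-mono le) (≤-reflexive (w-at (at-2x t)))

-- Were the step before time `2 * x (suc t)` a +, `cw` would put a - at position `x (suc t)`, where
-- `at-x-suc` has a +. Strictness keeps the argument `j` of `A-strict` in window `t`.
w-below-2x : ∀ t {v} → v < x (suc t) + x (suc t) → w v < x (suc t)
w-below-2x t {v} (s≤s v≤n) with dichotomy (c n)
  where
  n : ℕ
  n = x₀ (suc t) + x (suc t)
... | inj₂ e = ≤-trans (s≤s (w-mono v≤n)) (≤-reflexive (trans (sym (w-minus e)) (w-at (at-2x (suc t)))))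
... | inj₁ e = ⊥-elim (true≢false (c-at (at-x-suc t))
    (trans (cong c (sym (trans (sym (w-plus e)) (w-at (at-2x (suc t)))))) (Plus.cw (plus (s≤s z≤n) e) (s≤s (s≤s z≤n)))))

-- Absorbs a shift that is off by one: at a - the position moves back over a +, by `cu`, and a +
-- leaves `w` alone.
w-of-pred-u : ∀ {v i} → 1 ≤ v → suc i ≡ u (suc v) → w i ≡ w (u v)
w-of-pred-u {v} 1≤v eq with invariant v 1≤v
... | inj₁ (e , _) = cong w (suc-injective (trans eq (u-plus e)))
... | inj₂ (e , r) with Minus.cu r
...   | j , uj , cj = trans (cong w (suc-injective (trans eq (trans (u-minus e) uj)))) (trans (sym (w-plus cj)) (cong w (sym uj)))

-- Likewise for `u`: at a + the positions differ by a -, by `cw`, which leaves `u` alone.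
u-of-w-suc : ∀ {v} → 2 ≤ v → u (w (suc v)) ≡ u (suc (w v))
u-of-w-suc {v} 2≤v with invariant v (≤-trans (s≤s z≤n) 2≤v)
... | inj₁ (e , r) = trans (cong u (w-plus e)) (sym (u-minus (Plus.cw r 2≤v)))
... | inj₂ (e , _) = cong u (w-minus e)

-- A m ≡ u (suc (m + t)) ∸ 1 and B m ≡ w (suc (m + t)) with a shift t that grows by one each time
-- the pointers meet.
record Window (e : ℕ → ℕ) (t m : ℕ) : Set where
  constructor window
  field
    lower : e t ≤ m + t
    upper : suc (m + t) ≤ e (suc t)

WindowA WindowB : ℕ → ℕ → Set
WindowA = Window (λ t → x t + x t)
WindowB = Window x

record ValueA (t m : ℕ) : Set where
  constructor value
  field
    odd-A : OddA m
    eq-A  : suc (A m) ≡ u (suc (m + t))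

record ValueB (t m : ℕ) : Set where
  constructor value
  field
    odd-B : OddB m
    eq-B  : B m ≡ w (suc (m + t))

open ValueA
open ValueB

ClaimA ClaimB : ℕ → Set
ClaimA m = ∀ t → WindowA t m → ValueA t m
ClaimB m = ∀ t → WindowB t m → ValueB t m

-- Since `u v + w v ≡ suc v`, subtracting one counter from the index leaves the other: the argument
-- `i` of the recurrence is a value `p` of the opposite counter less a shift `d`.
pointer : ∀ {a p m d} → p + a ≡ suc m + d → d ≤ p → ∃[ i ] i + d ≡ p × i + a ≡ suc m
pointer {a} {p} {m} {d} eq le with m≤n⇒∃[o]m+o≡n le
... | i , refl = i , +-comm i d , +-cancelˡ-≡ d (i + a) (suc m)
    (trans (sym (+-assoc d i a)) (trans eq (+-comm (suc m) d)))

pointer₁ : ∀ {a p q m d} → p + q ≡ suc (suc m + d) → suc a ≡ q → d ≤ p → ∃[ i ] i + d ≡ p × i + a ≡ suc m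
pointer₁ {a} {p} eq refl = pointer (suc-injective (trans (sym (+-suc p a)) eq))

w+u : ∀ n → w n + u n ≡ suc n
w+u n = trans (+-comm (w n) (u n)) (u+w n)

-- `B` changes its shift at time `x (suc t)` and `A` at `2 * x (suc t)`, so window `t` of `A` meets
-- the windows `t` and `suc t` of `B`. In the second case `B m` is `w` one step later, and
-- `w-of-pred-u` makes up for it.
pointerB : ∀ t m → (∀ {i} → i ≤ m → ClaimB i) → x t + x t ≤ m + t → suc (suc (m + t)) ≤ x (suc t) + x (suc t) →
           ∃[ i ] i + B m ≡ suc m × OddB m × OddB i × B i ≡ w (u (suc (m + t)))
pointerB t m ih lo hi with suc (m + t) ≤? x (suc t)
... | yes le with ih ≤-refl t (window (≤-trans (<⇒≤ (x<2x t)) lo) le)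
...   | value om em with pointer {p = u v} (trans (cong (u v +_) em) (trans (u+w v) (cong suc (sym (+-suc m t)))))
                           (≤-trans (t<x t) (<⇒≤ (u-from-2x t (m≤n⇒m≤1+n lo))))
  where
  v : ℕ
  v = suc (m + t)
...     | i , ei , ea with ih (pointer-≤ ea (odd⇒1≤ om)) t (window
                             (≤-pred (≤-trans (u-from-2x t (m≤n⇒m≤1+n lo)) (≤-reflexive (trans (sym ei) (+-suc i t)))))
                             (≤-trans (≤-reflexive (trans (sym (+-suc i t)) ei))
                               (≤-trans (u-upto-diagonal t le) (<⇒≤ (2x<x-suc t)))))
...       | value oi vi = i , ea , om , oi , trans vi (cong w (trans (sym (+-suc i t)) ei))
pointerB t m ih lo hi | no gt with ih ≤-refl (suc t) (window
                               (≤-trans (<⇒≤ (≰⇒> gt)) (≤-reflexive (sym (+-suc m t))))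
                               (≤-trans (≤-reflexive (cong suc (+-suc m t))) (≤-trans hi (<⇒≤ (2x<x-suc (suc t))))))
... | value om em with pointer {p = u (suc v)} (trans (cong (u (suc v) +_) (trans em (cong (λ n → w (suc n)) (+-suc m t))))
                                  (trans (u+w (suc v)) (arith m t)))
                         (≤-trans (s≤s (t<x t)) (≤-trans (s≤s (<⇒≤ (x<2x t))) u-low))
  where
  v : ℕ
  v = suc (m + t)
  u-low : suc (x t + x t) ≤ u (suc v)
  u-low = u-past-diagonal t (m≤n⇒m≤1+n (≰⇒> gt))
  arith : ∀ m t → suc (suc (suc (m + t))) ≡ suc m + suc (suc t)
  arith = solve-∀
...   | i , ei , ea with ih (pointer-≤ ea (odd⇒1≤ om)) t (window
                           (≤-pred (≤-pred (≤-trans (≤-trans (s≤s (x<2x t)) (u-past-diagonal t (m≤n⇒m≤1+n (≰⇒> gt)))) (≤-reflexive eq))))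
                           (≤-pred (≤-trans (≤-reflexive (sym eq)) (u-upto-2x (suc t) hi))))
  where
  eq : u (suc (suc (m + t))) ≡ suc (suc (i + t))
  eq = trans (sym ei) (trans (+-suc i (suc t)) (cong suc (+-suc i t)))
...     | value oi vi = i , ea , om , oi , trans vi (w-of-pred-u (s≤s z≤n) (trans (sym (trans (+-suc i (suc t)) (cong suc (+-suc i t)))) ei))

-- With `B i` equal to `w (u v)` and `B j` to `w (suc (w v))`, where `v` is `suc (m + t)`, the
-- recurrence `A-step` becomes `u-rec`.
A-strict : ∀ t m → 1 ≤ m → (∀ {i} → i ≤ m → ClaimA i × ClaimB i) →
           x t + x t ≤ m + t → suc (suc (m + t)) ≤ x (suc t) + x (suc t) → ValueA t (suc m)
A-strict t m 1≤m ih lo hi with proj₁ (ih ≤-refl) t (window lo (<⇒≤ hi)) | pointerB t m (λ le → proj₂ (ih le)) lo hi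
... | value om em | i , ei , obm , oi , vi with pointer₁ (w+u (suc (m + t))) em (≤-trans (<⇒≤ (t<x t)) (w-from-2x t (m≤n⇒m≤1+n lo)))
...   | j , ej , ea with proj₂ (ih (pointer-≤ ea (odd⇒1≤ om))) t (window
                           (≤-trans (w-from-2x t (m≤n⇒m≤1+n lo)) (≤-reflexive (sym ej)))
                           (≤-trans (≤-reflexive (cong suc ej)) (w-below-2x t hi)))
...     | value oj vj with A-step {m} {i} {j} 1≤m obm om ei ea oi oj
...       | o , e = value o (trans e (trans (cong₂ _+_ vi (trans vj (cong (λ n → w (suc n)) ej)))
                      (sym (u-rec (suc (m + t)) (s≤s z≤n)))))

WindowA⇒1≤ : ∀ {t m} → WindowA t m → 1 ≤ m
WindowA⇒1≤ {t} {suc m} _             = s≤s z≤n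
WindowA⇒1≤ {t} {zero}  (window lo _) = ⊥-elim (<⇒≱ (t<x t) (≤-trans (m≤m+n (x t) (x t)) lo))

-- The counterpart of `pointerB`: within window `suc s` of `B`, the index `suc m` is in window `s`
-- or `suc s` of `A`, split at time `2 * x (suc s)`. Either way `i` falls in window `s`; in the
-- second case `u-of-w-suc` makes up for the later step.
pointerA : ∀ s m → (∀ {i} → i ≤ suc m → ClaimA i) → x (suc s) ≤ m + suc s → suc (suc (m + suc s)) ≤ x (suc (suc s)) →
           ∃[ i ] i + A (suc m) ≡ suc (suc m) × 1 ≤ i × OddA (suc m) × OddA i × suc (A i) ≡ u (suc (w (suc (m + suc s))))
pointerA s m ih lo hi with suc (m + suc s) ≤? x (suc s) + x (suc s)
... | yes le with ih ≤-refl s (window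
                    (≤-trans (<⇒≤ (2x<x-suc s)) (≤-trans lo (≤-reflexive (+-suc m s))))
                    (≤-trans (≤-reflexive (cong suc (sym (+-suc m s)))) le))
...   | value om em with pointer₁ (trans (w+u v) (cong (λ n → suc (suc n)) (+-suc m s))) (trans em (cong (λ n → u (suc n)) (sym (+-suc m s))))
                           (≤-trans (<⇒≤ (t<x s)) (≤-trans (<⇒≤ (x<2x s)) (w-from-diagonal s (m≤n⇒m≤1+n lo))))
  where
  v : ℕ
  v = suc (m + suc s)
...     | i , ei , ea = i , ea , WindowA⇒1≤ win , om , odd-A vi , trans (eq-A vi) (cong (λ n → u (suc n)) ei)
  where
  win : WindowA s i
  win = window (≤-trans (w-from-diagonal s (m≤n⇒m≤1+n lo)) (≤-reflexive (sym ei)))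
    (≤-trans (≤-reflexive (cong suc ei)) (≤-trans (s≤s (w-upto-2x (suc s) le)) (x<2x (suc s))))
  vi : ValueA s i
  vi = ih (pointer-≤ ea (odd⇒1≤ om)) s win
pointerA s m ih lo hi | no gt with ih ≤-refl (suc s) (window (<⇒≤ (≰⇒> gt)) (≤-trans hi (<⇒≤ (x<2x (suc (suc s))))))
... | value om em with pointer₁ (w+u (suc (suc (m + suc s)))) em
                         (≤-trans (<⇒≤ (t<x (suc s))) (w-from-2x (suc s) (m≤n⇒m≤1+n (<⇒≤ (≰⇒> gt)))))
...   | i , ei , ea = i , ea , WindowA⇒1≤ win , om , odd-A vi
                    , trans (eq-A vi) (trans (cong u eq) (u-of-w-suc (s≤s (≤-trans (s≤s z≤n) lo))))
  where
  eq : suc (i + s) ≡ w (suc (suc (m + suc s)))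
  eq = trans (sym (+-suc i s)) ei
  win : WindowA s i
  win = window
    (≤-pred (≤-trans (2x<x-suc s) (≤-trans (w-from-2x (suc s) (m≤n⇒m≤1+n (<⇒≤ (≰⇒> gt)))) (≤-reflexive (sym eq)))))
    (≤-trans (≤-reflexive eq) (w-upto-diagonal (suc s) hi))
  vi : ValueA s i
  vi = ih (pointer-≤ ea (odd⇒1≤ om)) s win

-- Through the walk `B-step` becomes `w-rec`. Both arguments lie in window `s` of `A`, one below
-- that of `B`, hence the positive shift; in window 0 only `B-two` has to be supplied.
B-strict-suc : ∀ s m → 1 ≤ m → (∀ {i} → i ≤ suc m → ClaimA i) → (∀ {i} → i ≤ m → ClaimB i) →
           x (suc s) ≤ m + suc s → suc (suc (m + suc s)) ≤ x (suc (suc s)) → ValueB (suc s) (suc m)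
B-strict-suc s m 1≤m ihA ihB lo hi with ihB ≤-refl (suc s) (window lo (<⇒≤ hi)) | pointerA s m ihA lo hi
... | value om em | i , ei , 1≤i , oam , oi , vi
  with pointer {p = u v} (trans (cong (u v +_) em) (u+w v)) (≤-trans (t<x s) (≤-trans (<⇒≤ (x<2x s)) (<⇒≤ (u-past-diagonal s (s≤s lo)))))
  where
  v : ℕ
  v = suc (m + suc s)
...   | j , ej , ea = value (proj₁ r) (suc-injective (suc-injective (begin
    2 + B (suc m)                            ≡⟨ cong (2 +_) (proj₂ r) ⟩
    2 + (A i + A j)                          ≡⟨ shift (A i) (A j) ⟩
    suc (A j) + suc (A i)                    ≡⟨ cong₂ _+_ (trans (eq-A vj) (cong u eq)) vi ⟩
    u (u v) + u (suc (w v))                  ≡⟨ w-rec v (s≤s z≤n) ⟨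
    2 + w (suc v)                            ∎)))
  where
  open ≡-Reasoning
  v : ℕ
  v = suc (m + suc s)
  shift : ∀ a b → 2 + (a + b) ≡ suc b + suc a
  shift = solve-∀
  eq : suc (j + s) ≡ u v
  eq = trans (sym (+-suc j s)) ej
  win : WindowA s j
  win = window (≤-pred (≤-trans (u-past-diagonal s (s≤s lo)) (≤-reflexive (sym eq))))
    (≤-trans (≤-reflexive eq) (u-upto-diagonal (suc s) (<⇒≤ hi)))
  vj : ValueA s j
  vj = ihA (pointer-≤ ea (odd⇒1≤ om)) s win
  r : OddB (suc m) × B (suc m) ≡ A i + A j
  r = B-step {m} {i} {j} 1≤m oam om ei ea 1≤i (WindowA⇒1≤ win) oi (odd-A vj)

u-three : u 3 ≡ 2
u-three = trans (u-minus (c-at (at-2x 0))) (u-at (at-2x 0))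

A-two : ValueA 0 2
A-two = value (odd refl) (sym u-three)

B-one : ValueB 0 1
B-one = value (odd refl) (sym (w-at (at-2x 0)))

B-two : ValueB 0 2
B-two = value (odd refl) (sym (w-at (at-x-suc 0)))

-- At the common end point of two consecutive windows both formulas agree.
A-claim : ∀ m → (∀ {i} → i ≤ m → ClaimA i × ClaimB i) → ClaimA (suc m)
A-claim m ih t (window lo hi) with m≤n⇒m<n∨m≡n lo
A-claim zero    ih t       (window lo hi) | inj₁ lt =
  ⊥-elim (<⇒≱ (t<x t) (≤-trans (m≤m+n (x t) (x t)) (≤-pred lt)))
A-claim (suc m) ih t       (window lo hi) | inj₁ lt = A-strict t (suc m) (s≤s z≤n) ih (≤-pred lt) hi
A-claim m       ih zero    (window lo hi) | inj₂ eq with trans (suc-injective eq) (+-identityʳ m)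
... | refl = A-two
A-claim m       ih (suc t) (window lo hi) | inj₂ eq =
  value (odd-A r) (trans (eq-A r) (trans (cong u end) (trans (sym (u-minus (c-at (at-2x (suc t))))) (cong (λ n → u (suc n)) eq))))
  where
  end : suc (suc m + t) ≡ x (suc t) + x (suc t)
  end = trans (cong suc (sym (+-suc m t))) (sym eq)
  below : x t + x t ≤ m + t
  below = ≤-pred (≤-pred (≤-trans (s≤s (2x<x-suc t)) (≤-trans (x<2x (suc t)) (≤-reflexive (sym end)))))
  1≤m : ∀ m → x t + x t ≤ m + t → 1 ≤ m
  1≤m zero    le = ⊥-elim (<⇒≱ (t<x t) (≤-trans (m≤m+n (x t) (x t)) le))
  1≤m (suc m) _  = s≤s z≤n
  r : ValueA t (suc m)
  r = A-strict t m (1≤m m below) ih below (≤-reflexive end)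

B-strict : ∀ t m → (∀ {i} → i ≤ suc m → ClaimA i) → (∀ {i} → i ≤ m → ClaimB i) →
            x t ≤ m + t → suc (suc (m + t)) ≤ x (suc t) → ValueB t (suc m)
B-strict zero (suc zero) _ _ _ _ = B-two
B-strict zero (suc (suc m)) _ _ _ (s≤s (s≤s (s≤s ())))
B-strict (suc s) (suc m) ihA ihB lo hi = B-strict-suc s (suc m) (s≤s z≤n) ihA ihB lo hi
B-strict zero zero _ _ () _
B-strict (suc s) zero _ _ lo _ = ⊥-elim (<⇒≱ (t<x (suc s)) lo)

B-claim : ∀ m → (∀ {i} → i ≤ suc m → ClaimA i) → (∀ {i} → i ≤ m → ClaimB i) → ClaimB (suc m)
B-claim m ihA ihB t (window lo hi) with m≤n⇒m<n∨m≡n lo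
... | inj₁ lt = B-strict t m ihA ihB (≤-pred lt) hi
B-claim m ihA ihB zero    (window lo hi) | inj₂ eq with trans (suc-injective eq) (+-identityʳ m)
... | refl = B-one
B-claim m ihA ihB (suc t) (window lo hi) | inj₂ eq =
  value (odd-B r) (trans (eq-B r) (trans (cong w end) (trans (sym (w-plus (c-at (at-x-suc t)))) (cong (λ n → w (suc n)) eq))))
  where
  end : suc (suc m + t) ≡ x (suc t)
  end = trans (cong suc (sym (+-suc m t))) (sym eq)
  below : x t ≤ m + t
  below = ≤-pred (≤-pred (≤-trans (s≤s (x<2x t)) (≤-trans (2x<x-suc t) (≤-reflexive (sym end)))))
  r : ValueB t (suc m)
  r = B-strict t m ihA ihB below (≤-reflexive end)

-- At each index `A` comes before `B`, because Q̃(2m) refers back to Q̃(2m - 1).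
claims : ∀ m → ClaimA m × ClaimB m
claims = <-rec (λ m → ClaimA m × ClaimB m) step
  where
  step : ∀ m → (∀ {i} → i < m → ClaimA i × ClaimB i) → ClaimA m × ClaimB m
  step zero    _  = (λ t win → ⊥-elim (1+n≰n (WindowA⇒1≤ win))) , λ t win → ⊥-elim (<⇒≱ (t<x t) (Window.lower win))
  step (suc m) ih = claimA , B-claim m ihA (λ le → proj₂ (ih (s≤s le)))
    where
    claimA : ClaimA (suc m)
    claimA = A-claim m (λ le → ih (s≤s le))
    ihA : ∀ {i} → i ≤ suc m → ClaimA i
    ihA le with m≤n⇒m<n∨m≡n le
    ... | inj₁ lt   = proj₁ (ih lt)
    ... | inj₂ refl = claimA

-- Counting

-- Consecutive windows share an end point, so `m` and `suc m` have a common window, and a step of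
-- `A` or `B` is a step of `u` or `w` under a single shift.
cover : ∀ {e} → (∀ t → 2 + e t ≤ e (suc t)) → ∀ {m} → e 0 ≤′ m → ∃[ t ] Window e t m × Window e t (suc m)
cover {e} gap ≤′-refl = 0 , window e₀ (<⇒≤ e₁) , window (m≤n⇒m≤1+n e₀) e₁
  where
  e₀ : e 0 ≤ e 0 + 0
  e₀ = m≤m+n (e 0) 0
  e₁ : 2 + (e 0 + 0) ≤ e 1
  e₁ = ≤-trans (≤-reflexive (cong (2 +_) (+-identityʳ (e 0)))) (gap 0)
cover {e} gap {suc m} (≤′-step le) with cover gap le
... | t , _ , window lo hi with m≤n⇒m<n∨m≡n hi
...   | inj₁ lt = t , window lo hi , window (m≤n⇒m≤1+n lo) lt
...   | inj₂ eq = suc t , window lo′ (<⇒≤ hi′) , window (m≤n⇒m≤1+n lo′) hi′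
  where
  eq′ : suc m + suc t ≡ e (suc t)
  eq′ = trans (+-suc (suc m) t) eq
  lo′ : e (suc t) ≤ suc m + suc t
  lo′ = ≤-reflexive (sym eq′)
  hi′ : 2 + (suc m + suc t) ≤ e (suc (suc t))
  hi′ = ≤-trans (≤-reflexive (cong (2 +_) eq′)) (gap (suc t))

A-suc : ∀ m → A m ≤ A (suc m)
A-suc 0 = z≤n
A-suc 1 = ≤-refl
A-suc m@(suc (suc _)) with cover gap (≤⇒≤′ {2} {m} (s≤s (s≤s z≤n)))
  where
  gap : ∀ t → 2 + (x t + x t) ≤ x (suc t) + x (suc t)
  gap t = ≤-trans (s≤s (2x<x-suc t)) (x<2x (suc t))
... | t , win , win′ = ≤-pred (≤-trans (≤-reflexive (eq-A (proj₁ (claims m) t win)))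
  (≤-trans (u-suc (suc (m + t))) (≤-reflexive (sym (eq-A (proj₁ (claims (suc m)) t win′))))))
  where open ValueA

B-suc : ∀ m → B m ≤ B (suc m)
B-suc 0 = z≤n
B-suc m@(suc _) with cover gap (≤⇒≤′ {1} {m} (s≤s z≤n))
  where
  gap : ∀ t → 2 + x t ≤ x (suc t)
  gap t = ≤-trans (s≤s (x<2x t)) (2x<x-suc t)
... | t , win , win′ = ≤-trans (≤-reflexive (eq-B (proj₂ (claims m) t win)))
  (≤-trans (w-suc (suc (m + t))) (≤-reflexive (sym (eq-B (proj₂ (claims (suc m)) t win′)))))
  where open ValueB

-- First passages through the powers of four

x≤4^ : ∀ t → x t ≤ 4 ^ t
x<4^ : ∀ t → x (suc t) < 4 ^ suc t
x≤4^ zero    = ≤-refl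
x≤4^ (suc t) = <⇒≤ (x<4^ t)
x<4^ t = ≤-trans (≤-reflexive (trans (x-suc t) (eq (x t)))) (*-monoʳ-≤ 4 (x≤4^ t))
  where
  eq : ∀ n → n + n + (n + n) ≡ 4 * n
  eq = solve-∀

-- Together with `x<4^` this puts the crossings of `4 ^ t` by `A` and `B`, for positive `t`, into
-- window `t`, so that both have the shift `t`.
2*4^<x : ∀ t → 4 ^ t + 4 ^ t < x (suc t)
2*4^<x zero    = ≤-refl
2*4^<x (suc t) = ≤-pred (≤-trans (≤-trans (≤-reflexive (cong (2 +_) (eq (4 ^ t))))
    (≤-trans (s≤s (s≤s (m≤n+m _ 2))) (≤-reflexive (eq′ (4 ^ t + 4 ^ t)))))
    (≤-trans (+-mono-≤ (+-mono-≤ ih ih) (+-mono-≤ ih ih)) (≤-reflexive (sym (x-suc (suc t))))))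
  where
  ih : 4 ^ t + 4 ^ t < x (suc t)
  ih = 2*4^<x t
  eq : ∀ n → 4 * n + 4 * n ≡ 4 * (n + n)
  eq = solve-∀
  eq′ : ∀ n → 4 + 4 * n ≡ suc n + suc n + (suc n + suc n)
  eq′ = solve-∀

-- The first index `s` with `n ≤ f s` is also the number of indices, 0 included, with `f m < n`.
record Jump (f : ℕ → ℕ) (n s : ℕ) : Set where
  field
    below : ∀ {m} → m < s → f m < n
    above : ∀ {m} → s ≤ m → n ≤ f m

jump : ∀ {f n m} → (∀ m → f m ≤ f (suc m)) → suc (f m) ≡ n → f (suc m) ≡ n → Jump f n (suc m)
jump {f} step eq eq′ = record
  { below = λ lt → ≤-trans (s≤s (monotone f step (≤-pred lt))) (≤-reflexive eq)
  ; above = λ le → ≤-trans (≤-reflexive (sym eq′)) (monotone f step le) }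

record Jumps (k : ℕ) : Set where
  field
    s      : ℕ
    jump-A : Jump A (4 ^ k) (2 * E k 1 + s)
    jump-B : Jump B (4 ^ k) s

-- Under a common shift the indices differ as the times do: `u` leaves `n = 4 ^ K` at time
-- `n + re K 1 − 1`, `w` is about to enter it at `n + le K 1 − 1`, and `re K 1` exceeds `le K 1` by
-- `2 * E K 1`.
jumps : ∀ k → Jumps k
jumps zero = record
  -- The dummy value `Qt 0 = 0` makes `A 0` and `B 0` zero, so index 0 lies below `4 ^ 0`.
  { s = 1 ; jump-A = jump {A} {m = 0} A-suc refl refl ; jump-B = jump {B} {m = 0} B-suc refl refl }
jumps (suc k) = record
  { s      = suc m
  ; jump-A = subst (Jump A n) (sym (+-suc (2 * e) m)) (jump A-suc A₁ (suc-injective A₂))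
  ; jump-B = jump B-suc (trans (cong suc B₁) (le-0 (suc k))) (trans B₂ (le-0 (suc k)))
  }
  where
  K n e z : ℕ
  K = suc k
  n = 4 ^ K
  e = E K 1
  z = lo K 0
  x<n : x K < n
  x<n = x<4^ k
  z≡ : suc z ≡ n + le K 1
  z≡ = trans (cong suc (sym (+-suc (le₀ K 0) (le₀ K 1)))) (cong (_+ le K 1) (le-0 K))
  z-lower : 2 + x K ≤ suc z
  z-lower = ≤-trans (s≤s x<n) (≤-trans (≤-reflexive (+-comm 1 n)) (≤-trans (+-monoʳ-≤ n (s≤s z≤n)) (≤-reflexive (sym z≡))))
  offset : ∃[ m ] 2 + (m + K) ≡ suc z
  offset with m≤n⇒∃[o]m+o≡n (≤-trans (s≤s (t<x K)) (≤-trans (n≤1+n _) z-lower))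
  ... | m , eq = m , trans (cong (2 +_) (+-comm m K)) eq
  m : ℕ
  m = proj₁ offset
  m≡ : suc (m + K) ≡ z
  m≡ = suc-injective (proj₂ offset)
  z-at : At z (suc (le K 1)) (le₀ K 0) false
  z-at = minus-at-4^ k
  z-upper : suc z ≤ x (suc K)
  z-upper = ≤-trans (≤-reflexive z≡) (≤-trans (+-monoʳ-≤ n (m+n≤o⇒m≤o (le K 1) (≤-reflexive (le+E K 1)))) (<⇒≤ (2*4^<x K)))
  winB : WindowB K m
  winB = window (≤-pred (≤-pred (≤-trans z-lower (≤-reflexive (sym (proj₂ offset)))))) (≤-trans (≤-reflexive m≡) (<⇒≤ z-upper))
  winB′ : WindowB K (suc m)
  winB′ = window (m≤n⇒m≤1+n (Window.lower winB)) (≤-trans (≤-reflexive (proj₂ offset)) z-upper)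
  B₁ : B m ≡ le₀ K 0
  B₁ = trans (ValueB.eq-B (proj₂ (claims m) K winB)) (trans (cong w m≡) (w-at z-at))
  B₂ : B (suc m) ≡ le K 0
  B₂ = trans (ValueB.eq-B (proj₂ (claims (suc m)) K winB′))
         (trans (cong w (proj₂ offset)) (trans (w-minus (c-at z-at)) (cong suc (w-at z-at))))
  y : ℕ
  y = suc (2 * e + m + K)
  y≡ : suc y ≡ n + re K 1
  y≡ = begin
    suc y                        ≡⟨ arith (2 * e) m K ⟩
    2 * e + (2 + (m + K))        ≡⟨ cong (2 * e +_) (trans (proj₂ offset) z≡) ⟩
    2 * e + (n + le K 1)         ≡⟨ arith′ e n (le K 1) ⟩
    n + ((le K 1 + e) + e)       ≡⟨ cong (λ a → n + (a + e)) (le+E K 1) ⟩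
    n + re K 1                   ∎
    where
    open ≡-Reasoning
    arith : ∀ a b c → 2 + (a + b + c) ≡ a + (2 + (b + c))
    arith = solve-∀
    arith′ : ∀ e n l → 2 * e + (n + l) ≡ n + ((l + e) + e)
    arith′ = solve-∀
  y-at : At y n (re K 1) true
  y-at = plus-at-4^ k y≡
  y-upper : suc y ≤ x (suc K) + x (suc K)
  y-upper = ≤-trans (≤-reflexive y≡)
    (≤-trans (+-monoʳ-≤ n (+-monoʳ-≤ n (m+n≤o⇒n≤o (le K 1) (≤-reflexive (le+E K 1)))))
      (≤-trans (m≤m+n _ n) (≤-trans (≤-reflexive (arith n)) (<⇒≤ (+-mono-< (2*4^<x K) (2*4^<x K))))))
    where
    arith : ∀ n → n + (n + n) + n ≡ n + n + (n + n)
    arith = solve-∀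
  winA : WindowA K (2 * e + m)
  winA = window
    (≤-pred (≤-pred (≤-trans (≤-reflexive (cong suc (sym (+-suc (x K) (x K)))))
      (≤-trans (+-mono-≤ x<n (≤-trans x<n (m≤m+n n e))) (≤-reflexive (sym y≡))))))
    (<⇒≤ y-upper)
  winA′ : WindowA K (suc (2 * e + m))
  winA′ = window (m≤n⇒m≤1+n (Window.lower winA)) y-upper
  A₁ : suc (A (2 * e + m)) ≡ n
  A₁ = trans (ValueA.eq-A (proj₁ (claims (2 * e + m)) K winA)) (u-at y-at)
  A₂ : suc (A (suc (2 * e + m))) ≡ suc n
  A₂ = trans (ValueA.eq-A (proj₁ (claims (suc (2 * e + m))) K winA′)) (trans (u-plus (c-at y-at)) (cong suc (u-at y-at)))

-- Fibres and counting functions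

module Counting (f : ℕ → ℕ) (N : ℕ) where

  fibre : ℕ → List ℕ
  fibre v = filter (λ m → f m ≟ v) (downFrom N)

  below : ℕ → List ℕ → List ℕ
  below n = filter (λ m → f m <? n)

  below-suc : ∀ v ms → length (below (suc v) ms) ≡ length (filter (λ m → f m ≟ v) ms) + length (below v ms)
  below-suc v [] = refl
  below-suc v (m ∷ ms) with <-cmp (f m) v
  ... | tri< lt ne _
    rewrite filter-accept (λ m → f m <? suc v) {x = m} {xs = ms} (m≤n⇒m≤1+n lt)
          | filter-reject (λ m → f m ≟ v) {x = m} {xs = ms} ne
          | filter-accept (λ m → f m <? v) {x = m} {xs = ms} lt
          = trans (cong suc (below-suc v ms)) (sym (+-suc _ _))
  ... | tri≈ ge eq _
    rewrite filter-accept (λ m → f m <? suc v) {x = m} {xs = ms} (s≤s (≤-reflexive eq))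
          | filter-accept (λ m → f m ≟ v) {x = m} {xs = ms} eq
          | filter-reject (λ m → f m <? v) {x = m} {xs = ms} ge
          = cong suc (below-suc v ms)
  ... | tri> ge ne gt
    rewrite filter-reject (λ m → f m <? suc v) {x = m} {xs = ms} (≤⇒≯ gt)
          | filter-reject (λ m → f m ≟ v) {x = m} {xs = ms} ne
          | filter-reject (λ m → f m <? v) {x = m} {xs = ms} ge
          = below-suc v ms

  length-below-all : ∀ {n s} → Jump f n s → ∀ M → M ≤ s → length (below n (downFrom M)) ≡ M
  length-below-all J zero    _  = refl
  length-below-all {n} J (suc M) le = trans
    (cong length (filter-accept (λ m → f m <? n) (Jump.below J le)))
    (cong suc (length-below-all J M (<⇒≤ le)))

  length-below : ∀ {n s M} → Jump f n s → s ≤′ M → length (below n (downFrom M)) ≡ s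
  length-below J ≤′-refl = length-below-all J _ ≤-refl
  length-below {n} J (≤′-step le) = trans
    (cong length (filter-reject (λ m → f m <? n) (≤⇒≯ (Jump.above J (≤′⇒≤ le)))))
    (length-below J le)

  count : ℕ → ℕ
  count n = length (below n (downFrom N))

  count-suc : ∀ v → count (suc v) ≡ length (fibre v) + count v
  count-suc v = below-suc v (downFrom N)

  -- With the cutoff `N` at the jump to `n`, every index of value below `n` is in the list. Index 0
  -- is there too, but its value 0 keeps it out of the fibres over `v ≥ 1`.
  fibre-count : f 0 ≡ 0 → ∀ {n} → Jump f n N → ∀ v → 1 ≤ v → v < n →
                HasCount (λ m → 1 ≤ m × f m ≡ v) (length (fibre v))
  fibre-count f0 J v 1≤v v<n = fibre v , filter⁺ (λ m → f m ≟ v) (downFrom⁺ N) , (λ m → mk⇔ to from) , refl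
    where
    positive : ∀ m → f m ≡ v → 1 ≤ m
    positive zero    eq = ⊥-elim (<⇒≱ 1≤v (≤-reflexive (trans (sym eq) f0)))
    positive (suc _) _  = s≤s z≤n
    to : ∀ {m} → m ∈ fibre v → 1 ≤ m × f m ≡ v
    to {m} m∈ with ∈-filter⁻ (λ m → f m ≟ v) {xs = downFrom N} m∈
    ... | _ , eq = positive m eq , eq
    from : ∀ {m} → 1 ≤ m × f m ≡ v → m ∈ fibre v
    from {m} (_ , eq) = ∈-filter⁺ (λ m → f m ≟ v)
      (∈-downFrom⁺ (≰⇒> λ N≤m → <⇒≱ v<n (≤-trans (Jump.above J N≤m) (≤-reflexive eq)))) eq

-- The telescoping sum

open import Data.Integer as ℤ using (ℤ; +_; _-_)
import Data.Integer.Properties as ℤ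
import Data.Integer.Tactic.RingSolver as ℤ-Solver

sumFrom-telescope : ∀ (g G : ℕ → ℤ) → (∀ v → g v ≡ G (suc v) - G v) → ∀ a l → sumFrom a l g ≡ G (a + l) - G a
sumFrom-telescope g G step a zero    = sym (trans (cong (λ b → G b - G a) (+-identityʳ a)) (ℤ.+-inverseʳ (G a)))
sumFrom-telescope g G step a (suc l) = begin
  g a ℤ.+ sumFrom (suc a) l g                              ≡⟨ cong₂ ℤ._+_ (step a) (sumFrom-telescope g G step (suc a) l) ⟩
  (G (suc a) - G a) ℤ.+ (G (suc a + l) - G (suc a))        ≡⟨ cancel (G (suc a)) (G a) (G (suc a + l)) ⟩
  G (suc a + l) - G a                                      ≡⟨ cong (λ b → G b - G a) (+-suc a l) ⟨
  G (a + suc l) - G a                                      ∎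
  where
  open ≡-Reasoning
  cancel : ∀ i j h → (i - j) ℤ.+ (h - i) ≡ h - j
  cancel = ℤ-Solver.solve-∀

theorem7p9 : (k : ℕ) →
    Σ (ℕ → ℕ) λ FA → Σ (ℕ → ℕ) λ FB →
    (∀ v → 4 ^ k ≤ v → v < 4 ^ (k + 1) → IsFA v (FA v) × IsFB v (FB v)) ×
    sumFrom (4 ^ k) (4 ^ (k + 1) ∸ 4 ^ k) (λ v → + FA v - + FB v)
    ≡ + ((2 * k + 2) C (k + 1))
theorem7p9 k = length ∘ CA.fibre , length ∘ CB.fibre , counts , total
  where
  module J = Jumps (jumps k)
  module J′ = Jumps (jumps (suc k))
  -- The cutoffs are the jumps to `4 ^ suc k`, so all indices with values in the block lie below
  -- them.
  module CA = Counting A (2 * E (suc k) 1 + J′.s)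
  module CB = Counting B J′.s

  k+1 : 4 ^ (k + 1) ≡ 4 ^ suc k
  k+1 = cong (4 ^_) (+-comm k 1)

  counts : ∀ v → 4 ^ k ≤ v → v < 4 ^ (k + 1) → IsFA v (length (CA.fibre v)) × IsFB v (length (CB.fibre v))
  counts v lo hi = CA.fibre-count refl J′.jump-A v 1≤v hi′ , CB.fibre-count refl J′.jump-B v 1≤v hi′
    where
    1≤v : 1 ≤ v
    1≤v = ≤-trans (m^n>0 4 k) lo
    hi′ : v < 4 ^ suc k
    hi′ = ≤-trans hi (≤-reflexive k+1)

  -- The increments of `G` are the differences of fibre sizes. At `4 ^ k` and `4 ^ suc k` it is the
  -- distance between the jumps of `A` and `B`; index 0 is counted on both sides and cancels.
  G : ℕ → ℤ
  G v = + CA.count v - + CB.count v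

  G-suc : ∀ v → + length (CA.fibre v) - + length (CB.fibre v) ≡ G (suc v) - G v
  G-suc v = sym (begin
    (+ CA.count (suc v) - + CB.count (suc v)) - G v
      ≡⟨ cong₂ (λ a b → (+ a - + b) - G v) (CA.count-suc v) (CB.count-suc v) ⟩
    (+ (length (CA.fibre v) + CA.count v) - + (length (CB.fibre v) + CB.count v)) - G v
      ≡⟨ cong₂ (λ a b → (a - b) - G v) (ℤ.pos-+ (length (CA.fibre v)) (CA.count v)) (ℤ.pos-+ (length (CB.fibre v)) (CB.count v)) ⟩
    ((+ length (CA.fibre v) ℤ.+ + CA.count v) - (+ length (CB.fibre v) ℤ.+ + CB.count v)) - G v
      ≡⟨ cancel (+ length (CA.fibre v)) (+ CA.count v) (+ length (CB.fibre v)) (+ CB.count v) ⟩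
    + length (CA.fibre v) - + length (CB.fibre v)   ∎)
    where
    open ≡-Reasoning
    cancel : ∀ a i b j → ((a ℤ.+ i) - (b ℤ.+ j)) - (i - j) ≡ a - b
    cancel = ℤ-Solver.solve-∀

  difference : ∀ e s → + (e + s) - + s ≡ + e
  difference e s = trans (cong (_- + s) (ℤ.pos-+ e s)) (cancel (+ e) (+ s))
    where
    cancel : ∀ i j → (i ℤ.+ j) - j ≡ i
    cancel = ℤ-Solver.solve-∀

  G-at : ∀ {j} (Z : Jumps j) → Jumps.s Z ≤ J′.s → 2 * E j 1 + Jumps.s Z ≤ 2 * E (suc k) 1 + J′.s →
         G (4 ^ j) ≡ + (2 * E j 1)
  G-at {j} Z le le′ = trans
    (cong₂ (λ a b → + a - + b) (CA.length-below (Jumps.jump-A Z) (≤⇒≤′ le′)) (CB.length-below (Jumps.jump-B Z) (≤⇒≤′ le)))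
    (difference (2 * E j 1) (Jumps.s Z))

  jump-≤ : ∀ {f s s′} → Jump f (4 ^ k) s → Jump f (4 ^ suc k) s′ → s ≤ s′
  jump-≤ {f} {s} {s′} i j = ≮⇒≥ λ s′<s →
    <⇒≱ (Jump.below i s′<s) (≤-trans (^-monoʳ-≤ 4 (n≤1+n k)) (Jump.above j ≤-refl))

  total : sumFrom (4 ^ k) (4 ^ (k + 1) ∸ 4 ^ k) (λ v → + length (CA.fibre v) - + length (CB.fibre v))
          ≡ + ((2 * k + 2) C (k + 1))
  total = begin
    sumFrom (4 ^ k) (4 ^ (k + 1) ∸ 4 ^ k) (λ v → + length (CA.fibre v) - + length (CB.fibre v))
      ≡⟨ sumFrom-telescope _ G G-suc (4 ^ k) (4 ^ (k + 1) ∸ 4 ^ k) ⟩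
    G (4 ^ k + (4 ^ (k + 1) ∸ 4 ^ k)) - G (4 ^ k)
      ≡⟨ cong (λ n → G n - G (4 ^ k)) (trans (m+[n∸m]≡n (^-monoʳ-≤ 4 (m≤m+n k 1))) k+1) ⟩
    G (4 ^ suc k) - G (4 ^ k)
      ≡⟨ cong₂ _-_ (G-at (jumps (suc k)) ≤-refl ≤-refl) (G-at (jumps k) (jump-≤ J.jump-B J′.jump-B) (jump-≤ J.jump-A J′.jump-A)) ⟩
    + (2 * E (suc k) 1) - + (2 * E k 1)
      ≡⟨ cong (λ n → + n - + (2 * E k 1)) (trans (E-increment k) (+-comm (2 * E k 1) _)) ⟩
    + (((2 * k + 2) C (k + 1)) + 2 * E k 1) - + (2 * E k 1)
      ≡⟨ difference ((2 * k + 2) C (k + 1)) (2 * E k 1) ⟩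
    + ((2 * k + 2) C (k + 1))   ∎
    where open ≡-Reasoning
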